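{- Fix integers $m\ge 2$ and $c\ge 1$. There exist constants $C,s_0>0$ depending only on $m,c$ such that for all integers $s\ge s_0$, with $n=ms+c$ and $\ell=s-c$, every shifted family $\mathcal F\subset 2^{[n]}$ with $\nu(\mathcal F)<s$ satisfies \[ |2^{[n]}\setminus\mathcal F|\ge (2c+3)\binom{n}{m-1}-Cs^{m-2} \] provided one of the following holds: \begin{itemize} \item $c\ge 2$ and $\mathcal F\not\subseteq\mathcal Q(m,s,\ell)$; \item $c=1$, $\mathcal F\not\subseteq\mathcal Q(m,s,\ell)$ and $\mathcal F\not\subseteq\mathcal W(m,s,\ell)$. \end{itemize}
   Context: $[b]=\{1,\dots,b\}$. $\nu(\mathcal F)$ is the maximum number of pairwise disjoint sets in $\mathcal F$. $\mathcal Q(m,s,\ell)=\{P\subset[n]:|P|+|P\cap[ms-c-1]|\ge 2m\}$ and $\mathcal W(m,s,\ell)=\{P\subset[n]:|P\cap[ms-1]|\ge m\}$. Writing a set as $(a_1,\dots,a_k)$ with $a_1<\dots<a_k$, $(a_1,\dots,a_k)$ can be shifted to $(b_1,\dots,b_k)$ if $a_i\ge b_i$ for all $i$; a family is shifted if it is closed under this operation. (The paper writes the error term as $+O(s^{m-2})$ with $m,c$ fixed, $s\to\infty$.) -}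

module Defs where

open import Data.Nat using (ℕ; zero; suc; _+_; _*_; _∸_; _≤_; _≤?_)
open import Data.Bool using (Bool; true; false; not; if_then_else_)
open import Data.List using (List; []; _∷_; _++_; map; length; filter)
open import Data.List.Relation.Binary.Pointwise using (Pointwise)
open import Data.Fin using (Fin)
open import Data.Fin.Subset using (Subset; inside; outside; _∩_; ∣_∣; Empty)
open import Data.Vec using (Vec; []; _∷_)
open import Data.Product using (Σ; ∃; _×_)
open import Relation.Nullary using (¬_)
open import Relation.Binary.PropositionalEquality using (_≡_; _≢_)

-- A family of subsets of [n] (elements of [n] = {1,…,n} are encoded by Fin n,
-- the index i standing for the element i+1), given by its characteristic function.
Family : ℕ → Set
Family n = Subset n → Bool

allSubsets : (n : ℕ) → List (Subset n)
allSubsets zero = [] ∷ []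
allSubsets (suc n) = map (inside ∷_) (allSubsets n) ++ map (outside ∷_) (allSubsets n)

countTrue : {A : Set} → (A → Bool) → List A → ℕ
countTrue p [] = 0
countTrue p (x ∷ xs) = (if p x then 1 else 0) + countTrue p xs

complementSize : {n : ℕ} → Family n → ℕ
complementSize {n} F = countTrue (λ P → not (F P)) (allSubsets n)

elems : {n : ℕ} → Subset n → List ℕ
elems [] = []
elems (true ∷ p) = 1 ∷ map suc (elems p)
elems (false ∷ p) = map suc (elems p)

ShiftsTo : {n : ℕ} → Subset n → Subset n → Set
ShiftsTo A B = Pointwise (λ a b → b ≤ a) (elems A) (elems B)

Shifted : {n : ℕ} → Family n → Set
Shifted F = ∀ A B → F A ≡ true → ShiftsTo A B → F B ≡ true

Disjoint : {n : ℕ} → Subset n → Subset n → Set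
Disjoint A B = Empty (A ∩ B)

HasDisjointMembers : {n : ℕ} → Family n → ℕ → Set
HasDisjointMembers {n} F k =
  Σ (Fin k → Subset n) λ A →
    (∀ i → F (A i) ≡ true) ×
    (∀ i j → i ≢ j → Disjoint (A i) (A j) × A i ≢ A j)

νLess : {n : ℕ} → Family n → ℕ → Set
νLess F s = ¬ HasDisjointMembers F s

countUpTo : {n : ℕ} → ℕ → Subset n → ℕ
countUpTo t P = length (filter (_≤? t) (elems P))

InQ : {n : ℕ} → (m s c : ℕ) → Subset n → Set
InQ m s c P = 2 * m ≤ ∣ P ∣ + countUpTo (m * s ∸ c ∸ 1) P

InW : {n : ℕ} → (m s : ℕ) → Subset n → Set
InW m s P = m ≤ countUpTo (m * s ∸ 1) P

NotSubfamily : {n : ℕ} → Family n → (Subset n → Set) → Set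
NotSubfamily F G = ∃ λ P → F P ≡ true × ¬ G P

{-# OPTIONS --safe #-}
module Submission where

-- Cut [n] into a front of bounded size, a middle of size pm and a tail of 2c+2 elements.
-- If the number of missing sets is less than (2c+3) C(pm−1, m−1), then averaging yields both a
-- partition of the middle into m-sets of which at most 2c+2 are missing, and an (m−1)-set G in
-- the middle such that at most 2c+2 of the sets G ∪ S, with S in the tail, are missing.
-- By shiftedness every (m−1)-subset of the front does at least as well as G. It can therefore
-- be completed by the good tail sets, and by single elements of the few missing m-sets, so that
-- no element is wasted. A study of the tail family shows that s disjoint members arise in this
-- way, except when the missing pattern is exactly that of Q or (for c = 1) that of W; in
-- those cases a member outside Q or W, with its head shifted to the front, supplies the last set.

open import Defs
open import Data.Bool using (Bool; true; false; not; if_then_else_)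
open import Data.Fin using (Fin; zero; suc)
open import Data.Fin.Subset using (Subset; ∣_∣; ⊥; ⊤; _∈_)
open import Data.Fin.Subset.Properties using (∣⊥∣≡0; ∣⊤∣≡n; x∈p∩q⁻; x∈p∩q⁺)
open import Data.List using (List; []; _∷_; map; length; filter) renaming (_++_ to _++ᴸ_)
open import Data.List.Properties using (map-∘; map-cong; map-id; ++-assoc; length-++)
open import Data.List.Relation.Binary.Pointwise using (Pointwise; []; _∷_)
open import Data.List.Relation.Unary.All as All using (All; []; _∷_)
import Data.List.Relation.Unary.All.Properties as Allₚ
open import Data.Nat using (ℕ; zero; suc; _+_; _*_; _∸_; _^_; _≤_; _<_; z≤n; s≤s; _≤?_; _<?_; _<ᵇ_; pred; >-nonZero)
open import Data.Nat.Combinatorics using (_C_; nCk+nC[k+1]≡[n+1]C[k+1]; nCk≡nC[n∸k]; nCn≡1; nC1≡n; k>n⇒nCk≡0)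
open import Data.Nat.Properties
open import Data.Nat.Tactic.RingSolver using (solve-∀)
open import Data.Product using (∃; _×_; _,_; proj₁; proj₂)
open import Data.Sum using (_⊎_; inj₁; inj₂)
open import Data.Vec using ([]; _∷_; _++_; here; there; splitAt)
import Data.Vec.Functional as Fun
open import Function using (_∘_)
open import Relation.Nullary using (¬_; yes; no; contradiction)
open import Relation.Binary.PropositionalEquality using (_≡_; _≢_; refl; sym; trans; cong; cong₂; subst; subst₂; module ≡-Reasoning)

-- Separation, shifting and initial segments

-- The sizes are forced by a tight balance: s sets of m elements take ms of the n = ms + c points,
-- so only c points may be wasted in all. The front holds exactly what the recycled blocks and the
-- tail sets consume, which leaves 2c + 2 tail points for the last 2 + c members, each using m - 1
-- front points. In the tail every pair wastes one point compared with a singleton. The same number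
-- 2c + 2 is the allowance for missing sets: the empty set and the tail singletons together are 2c +
-- 3, so one of them must be present. If only one singleton is present, it and c pairs fill 2c + 1
-- tail points and the packing is one member short; this is the pattern of Q. With more present
-- singletons such a shortage survives the counting only for c = 1, as the pattern of W. The error
-- term has a single source: the argument works with C(pm - 1, m - 1), and pm differs from n by an
-- amount independent of s.

∣++∣ : ∀ {a b} (A : Subset a) (B : Subset b) → ∣ A ++ B ∣ ≡ ∣ A ∣ + ∣ B ∣
∣++∣ [] B = refl
∣++∣ (true ∷ A) B = cong suc (∣++∣ A B)
∣++∣ (false ∷ A) B = ∣++∣ A B

⊥-++ : ∀ a {b} → ⊥ {a} ++ ⊥ {b} ≡ ⊥ {a + b}
⊥-++ zero = refl
⊥-++ (suc a) = cong (false ∷_) (⊥-++ a)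

∣p∣≡0⇒p≡⊥ : ∀ {n} (P : Subset n) → ∣ P ∣ ≡ 0 → P ≡ ⊥
∣p∣≡0⇒p≡⊥ [] _ = refl
∣p∣≡0⇒p≡⊥ (false ∷ P) e = cong (false ∷_) (∣p∣≡0⇒p≡⊥ P e)

-- `skip` accepts both values of `b`, so `A` and `B` are disjoint parts of `U` that may leave points
-- of `U` over; wasted points need no bookkeeping.
data Sep : ∀ {n} → Subset n → Subset n → Subset n → Set where
  []    : Sep [] [] []
  skip  : ∀ {n b} {U A B : Subset n} → Sep U A B → Sep (b ∷ U) (false ∷ A) (false ∷ B)
  left  : ∀ {n} {U A B : Subset n} → Sep U A B → Sep (true ∷ U) (true ∷ A) (false ∷ B)
  right : ∀ {n} {U A B : Subset n} → Sep U A B → Sep (true ∷ U) (false ∷ A) (true ∷ B)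

sep-++ : ∀ {a b} {U A B : Subset a} {U′ A′ B′ : Subset b} →
  Sep U A B → Sep U′ A′ B′ → Sep (U ++ U′) (A ++ A′) (B ++ B′)
sep-++ [] q = q
sep-++ (skip p) q = skip (sep-++ p q)
sep-++ (left p) q = left (sep-++ p q)
sep-++ (right p) q = right (sep-++ p q)

sep-⊤ : ∀ {n} {U A B : Subset n} → Sep U A B → Sep ⊤ A B
sep-⊤ [] = []
sep-⊤ (skip p) = skip (sep-⊤ p)
sep-⊤ (left p) = left (sep-⊤ p)
sep-⊤ (right p) = right (sep-⊤ p)

sep-⊥ˡ : ∀ {n} (U : Subset n) → Sep U ⊥ U
sep-⊥ˡ [] = []
sep-⊥ˡ (true ∷ U) = right (sep-⊥ˡ U)
sep-⊥ˡ (false ∷ U) = skip (sep-⊥ˡ U)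

sep-choose : ∀ a b {n} (U : Subset n) → a + b ≤ ∣ U ∣ →
  ∃ λ A → ∃ λ B → Sep U A B × ∣ A ∣ ≡ a × b ≤ ∣ B ∣
sep-choose zero b {n} U h = ⊥ , U , sep-⊥ˡ U , ∣⊥∣≡0 n , h
sep-choose (suc a) b (false ∷ U) h with sep-choose (suc a) b U h
... | A , B , s , e , l = false ∷ A , false ∷ B , skip s , e , l
sep-choose (suc a) b (true ∷ U) (s≤s h) with sep-choose a b U h
... | A , B , s , e , l = true ∷ A , false ∷ B , left s , cong suc e , l

sep-∈ˡ : ∀ {n} {U A B : Subset n} → Sep U A B → ∀ {x} → x ∈ A → x ∈ U
sep-∈ˡ (skip s) (there p) = there (sep-∈ˡ s p)
sep-∈ˡ (left s) here = here
sep-∈ˡ (left s) (there p) = there (sep-∈ˡ s p)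
sep-∈ˡ (right s) (there p) = there (sep-∈ˡ s p)

sep-∈ʳ : ∀ {n} {U A B : Subset n} → Sep U A B → ∀ {x} → x ∈ B → x ∈ U
sep-∈ʳ (skip s) (there p) = there (sep-∈ʳ s p)
sep-∈ʳ (right s) here = here
sep-∈ʳ (left s) (there p) = there (sep-∈ʳ s p)
sep-∈ʳ (right s) (there p) = there (sep-∈ʳ s p)

sep-disjoint : ∀ {n} {U A B : Subset n} → Sep U A B → ∀ {x} → x ∈ A → ¬ x ∈ B
sep-disjoint (skip s) (there p) (there q) = sep-disjoint s p q
sep-disjoint (left s) (there p) (there q) = sep-disjoint s p q
sep-disjoint (right s) (there p) (there q) = sep-disjoint s p q

-- The invariant is k = (elements of B so far) − (elements of A so far), so Dom 0 0 A B
-- says that every initial segment contains at least as many elements of B as of A.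
data Dom : ∀ {n} → ℕ → ℕ → Subset n → Subset n → Set where
  []   : ∀ {k} → Dom k k [] []
  same : ∀ {n k k′ b} {A B : Subset n} → Dom k k′ A B → Dom k k′ (b ∷ A) (b ∷ B)
  up   : ∀ {n k k′} {A B : Subset n} → Dom (suc k) k′ A B → Dom k k′ (false ∷ A) (true ∷ B)
  down : ∀ {n k k′} {A B : Subset n} → Dom k k′ A B → Dom (suc k) k′ (true ∷ A) (false ∷ B)

dom-refl : ∀ {n} (A : Subset n) → Dom 0 0 A A
dom-refl [] = []
dom-refl (b ∷ A) = same (dom-refl A)

dom-++ : ∀ {a b k k′ k″} {A B : Subset a} {A′ B′ : Subset b} →
  Dom k k′ A B → Dom k′ k″ A′ B′ → Dom k k″ (A ++ A′) (B ++ B′)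
dom-++ [] q = q
dom-++ (same p) q = same (dom-++ p q)
dom-++ (up p) q = up (dom-++ p q)
dom-++ (down p) q = down (dom-++ p q)

-- Once the surplus `k` covers all of `A`, no initial segment can fail, and only the sizes have to
-- match.
dom-slack : ∀ {n} k k′ (A B : Subset n) → ∣ A ∣ ≤ k → k + ∣ B ∣ ≡ k′ + ∣ A ∣ → Dom k k′ A B
dom-slack k k′ [] [] h e with trans (sym (+-identityʳ k)) (trans e (+-identityʳ k′))
... | refl = []
dom-slack (suc k) k′ (true ∷ A) (true ∷ B) (s≤s h) e =
  same (dom-slack (suc k) k′ A B (m≤n⇒m≤1+n h)
    (cong pred (trans (sym (+-suc (suc k) ∣ B ∣)) (trans e (+-suc k′ ∣ A ∣)))))
dom-slack (suc k) k′ (true ∷ A) (false ∷ B) (s≤s h) e =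
  down (dom-slack k k′ A B h (cong pred (trans e (+-suc k′ ∣ A ∣))))
dom-slack k k′ (false ∷ A) (true ∷ B) h e =
  up (dom-slack (suc k) k′ A B (m≤n⇒m≤1+n h) (trans (sym (+-suc k ∣ B ∣)) e))
dom-slack k k′ (false ∷ A) (false ∷ B) h e = same (dom-slack k k′ A B h e)

dom-⊥ˡ : ∀ {n} k (B : Subset n) → Dom k (k + ∣ B ∣) ⊥ B
dom-⊥ˡ {n} k B = dom-slack k (k + ∣ B ∣) ⊥ B (≤-trans (≤-reflexive (∣⊥∣≡0 n)) z≤n)
  (trans (sym (+-identityʳ _)) (cong (k + ∣ B ∣ +_) (sym (∣⊥∣≡0 n))))

initial : ∀ n → ℕ → Subset n
initial n zero = ⊥
initial zero (suc r) = []
initial (suc n) (suc r) = true ∷ initial n r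

∣initial∣ : ∀ n r → r ≤ n → ∣ initial n r ∣ ≡ r
∣initial∣ n zero h = ∣⊥∣≡0 n
∣initial∣ (suc n) (suc r) (s≤s h) = cong suc (∣initial∣ n r h)

final : ∀ n → ℕ → Subset n
final n zero = ⊤
final zero (suc r) = []
final (suc n) (suc r) = false ∷ final n r

sep-initial : ∀ n r → Sep ⊤ (initial n r) (final n r)
sep-initial n zero = sep-⊥ˡ ⊤
sep-initial zero (suc r) = []
sep-initial (suc n) (suc r) = left (sep-initial n r)

∣final∣ : ∀ n r → r ≤ n → ∣ final n r ∣ + r ≡ n
∣final∣ n zero h = trans (+-identityʳ _) (∣⊤∣≡n n)
∣final∣ (suc n) (suc r) (s≤s h) = trans (+-suc _ r) (cong suc (∣final∣ n r h))

-- The surplus never drops while the segment runs. When it ends, the surplus covers what is left of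
-- `A`, and `dom-slack` finishes.
dom-initial : ∀ {n} k k′ r (A : Subset n) → r ≤ n → k + r ≡ k′ + ∣ A ∣ → Dom k k′ A (initial n r)
dom-initial {n} k k′ zero A h e = dom-slack k k′ A ⊥
  (≤-trans (m≤n+m ∣ A ∣ k′) (≤-reflexive (trans (sym e) (+-identityʳ k))))
  (trans (cong (k +_) (∣⊥∣≡0 n)) e)
dom-initial k k′ (suc r) (true ∷ A) (s≤s h) e = same (dom-initial k k′ r A h
  (cong pred (trans (sym (+-suc k r)) (trans e (+-suc k′ ∣ A ∣)))))
dom-initial k k′ (suc r) (false ∷ A) (s≤s h) e =
  up (dom-initial (suc k) k′ r A h (trans (sym (+-suc k r)) e))

elemsFrom : ∀ {n} → ℕ → Subset n → List ℕ
elemsFrom o [] = []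
elemsFrom o (true ∷ P) = suc o ∷ elemsFrom (suc o) P
elemsFrom o (false ∷ P) = elemsFrom (suc o) P

map-elems : ∀ {n} o (P : Subset n) → map (o +_) (elems P) ≡ elemsFrom o P
map-suc-elems : ∀ {n} o (P : Subset n) → map (o +_) (map suc (elems P)) ≡ elemsFrom (suc o) P
map-elems o [] = refl
map-elems o (true ∷ P) = cong₂ _∷_ (+-comm o 1) (map-suc-elems o P)
map-elems o (false ∷ P) = map-suc-elems o P
map-suc-elems o P = trans (sym (map-∘ (elems P))) (trans (map-cong (+-suc o) (elems P)) (map-elems (suc o) P))

elems≡elemsFrom : ∀ {n} (P : Subset n) → elems P ≡ elemsFrom 0 P
elems≡elemsFrom P = trans (sym (map-id (elems P))) (map-elems 0 P)

-- ps holds the elements of B not yet matched with an element of A; they all lie below A.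
dom-pointwise : ∀ {n k} o (ps : List ℕ) {A B : Subset n} → length ps ≡ k → All (_≤ o) ps → Dom k 0 A B →
  Pointwise (λ a b → b ≤ a) (elemsFrom o A) (ps ++ᴸ elemsFrom o B)
dom-pointwise-snoc : ∀ {n k} o (ps : List ℕ) {A B : Subset n} → length ps ≡ k → All (_≤ o) ps → Dom (suc k) 0 A B →
  Pointwise (λ a b → b ≤ a) (elemsFrom (suc o) A) (ps ++ᴸ suc o ∷ elemsFrom (suc o) B)
dom-pointwise o [] e h [] = []
dom-pointwise o ps e h (same {b = false} d) = dom-pointwise (suc o) ps e (All.map m≤n⇒m≤1+n h) d
dom-pointwise o [] refl h (same {b = true} d) = ≤-refl ∷ dom-pointwise (suc o) [] refl [] d
dom-pointwise o (p ∷ ps) refl (h ∷ hs) (same {b = true} d) =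
  m≤n⇒m≤1+n h ∷ dom-pointwise-snoc o ps refl hs d
dom-pointwise o ps e h (up d) = dom-pointwise-snoc o ps e h d
dom-pointwise o (p ∷ ps) refl (h ∷ hs) (down d) =
  m≤n⇒m≤1+n h ∷ dom-pointwise (suc o) ps refl (All.map m≤n⇒m≤1+n hs) d
dom-pointwise-snoc o ps {A} {B} refl h d = subst (Pointwise (λ a b → b ≤ a) (elemsFrom (suc o) A))
  (++-assoc ps (suc o ∷ []) (elemsFrom (suc o) B))
  (dom-pointwise (suc o) (ps ++ᴸ suc o ∷ []) (trans (length-++ ps) (+-comm (length ps) 1))
    (Allₚ.++⁺ (All.map m≤n⇒m≤1+n h) (≤-refl ∷ [])) d)

dom⇒shiftsTo : ∀ {n} {A B : Subset n} → Dom 0 0 A B → ShiftsTo A B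
dom⇒shiftsTo {A = A} {B} d =
  subst₂ (Pointwise (λ a b → b ≤ a)) (sym (elems≡elemsFrom A)) (sym (elems≡elemsFrom B))
    (dom-pointwise 0 [] refl [] d)

DomClosed : ∀ {n} → Family n → Set
DomClosed F = ∀ {A B} → Dom 0 0 A B → F A ≡ true → F B ≡ true

shifted⇒domClosed : ∀ {n} {F : Family n} → Shifted F → DomClosed F
shifted⇒domClosed sh {A} {B} d FA = sh A B FA (dom⇒shiftsTo d)

domClosed-false : ∀ {n} {F : Family n} → DomClosed F → ∀ {A B} → Dom 0 0 A B → F B ≡ false → F A ≡ false
domClosed-false {F = F} cl {A} {B} d FB with F A in e
... | false = refl
... | true = contradiction (trans (sym (cl d e)) FB) λ ()

∣p∩[_]∣ : ∀ {n} → ℕ → Subset n → ℕ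
∣p∩[ zero ]∣ P = 0
∣p∩[ suc k ]∣ [] = 0
∣p∩[ suc k ]∣ (true ∷ P) = suc (∣p∩[ k ]∣ P)
∣p∩[ suc k ]∣ (false ∷ P) = ∣p∩[ k ]∣ P

filter-suc≤0 : ∀ xs → filter (_≤? 0) (map suc xs) ≡ []
filter-suc≤0 [] = refl
filter-suc≤0 (x ∷ xs) = filter-suc≤0 xs

filter-suc≤suc : ∀ k xs → length (filter (_≤? suc k) (map suc xs)) ≡ length (filter (_≤? k) xs)
filter-suc≤suc k [] = refl
filter-suc≤suc k (zero ∷ xs) = cong suc (filter-suc≤suc k xs)
filter-suc≤suc k (suc x ∷ xs) with x <ᵇ k
... | true = cong suc (filter-suc≤suc k xs)
... | false = filter-suc≤suc k xs

countUpTo≡ : ∀ {n} k (P : Subset n) → countUpTo k P ≡ ∣p∩[ k ]∣ P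
countUpTo≡ zero [] = refl
countUpTo≡ zero (true ∷ P) = cong length (filter-suc≤0 (elems P))
countUpTo≡ zero (false ∷ P) = cong length (filter-suc≤0 (elems P))
countUpTo≡ (suc k) [] = refl
countUpTo≡ (suc k) (true ∷ P) = cong suc (trans (filter-suc≤suc k (elems P)) (countUpTo≡ k P))
countUpTo≡ (suc k) (false ∷ P) = trans (filter-suc≤suc k (elems P)) (countUpTo≡ k P)

∣p∩[]∣-++ : ∀ {a b} k (A : Subset a) (B : Subset b) → ∣p∩[ a + k ]∣ (A ++ B) ≡ ∣ A ∣ + ∣p∩[ k ]∣ B
∣p∩[]∣-++ k [] B = refl
∣p∩[]∣-++ k (true ∷ A) B = cong suc (∣p∩[]∣-++ k A B)
∣p∩[]∣-++ k (false ∷ A) B = ∣p∩[]∣-++ k A B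

-- Sums over k-subsets and the averaging argument

nC0≡1 : ∀ n → n C 0 ≡ 1
nC0≡1 n = trans (nCk≡nC[n∸k] {0} {n} z≤n) (nCn≡1 n)

pascal : ∀ n k → suc n C suc k ≡ n C k + n C suc k
pascal n k = sym (nCk+nC[k+1]≡[n+1]C[k+1] n k)

nCk≤n^k : ∀ n k → n C k ≤ n ^ k
nCk≤n^k n zero = ≤-reflexive (nC0≡1 n)
nCk≤n^k zero (suc k) = ≤-reflexive (k>n⇒nCk≡0 {0} {suc k} (s≤s z≤n))
nCk≤n^k (suc n) (suc k) = begin
  suc n C suc k          ≡⟨ pascal n k ⟩
  n C k + n C suc k      ≤⟨ +-mono-≤ (nCk≤n^k n k) (nCk≤n^k n (suc k)) ⟩
  n ^ k + n * n ^ k      ≤⟨ *-monoʳ-≤ (suc n) (^-monoˡ-≤ k (n≤1+n n)) ⟩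
  suc n * suc n ^ k      ∎
  where open ≤-Reasoning

C-monoˡ : ∀ n k → n C k ≤ suc n C k
C-monoˡ n zero = ≤-reflexive (trans (nC0≡1 n) (sym (nC0≡1 (suc n))))
C-monoˡ n (suc k) = ≤-trans (m≤n+m _ (n C k)) (≤-reflexive (sym (pascal n k)))

[a+d]C≤ : ∀ a d j → (d + a) C suc j ≤ a C suc j + d * (d + a) ^ j
[a+d]C≤ a zero j = ≤-reflexive (sym (+-identityʳ _))
[a+d]C≤ a (suc d) j = begin
  suc (d + a) C suc j                                  ≡⟨ pascal (d + a) j ⟩
  (d + a) C j + (d + a) C suc j                        ≤⟨ +-mono-≤ (nCk≤n^k (d + a) j) ([a+d]C≤ a d j) ⟩
  (d + a) ^ j + (a C suc j + d * (d + a) ^ j)          ≡⟨ lem ((d + a) ^ j) (a C suc j) d ⟩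
  a C suc j + suc d * (d + a) ^ j                      ≤⟨ +-monoʳ-≤ (a C suc j) (*-monoʳ-≤ (suc d) (^-monoˡ-≤ j (n≤1+n (d + a)))) ⟩
  a C suc j + suc d * suc (d + a) ^ j                  ∎
  where
  open ≤-Reasoning
  lem : ∀ x y d → x + (y + d * x) ≡ y + suc d * x
  lem = solve-∀

nCk>0 : ∀ {n k} → k ≤ n → 1 ≤ n C k
nCk>0 {n} {zero} h = ≤-reflexive (sym (nC0≡1 n))
nCk>0 {suc n} {suc k} (s≤s h) =
  ≤-trans (nCk>0 h) (≤-trans (m≤m+n _ (n C suc k)) (≤-reflexive (sym (pascal n k))))

absorption : ∀ n k → suc k * (suc n C suc k) ≡ suc n * (n C k)
absorption n zero = trans (+-identityʳ _) (trans (nC1≡n (suc n)) (sym (trans (cong (suc n *_) (nC0≡1 n)) (*-identityʳ _))))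
absorption zero (suc k) = trans (cong (suc (suc k) *_) (k>n⇒nCk≡0 {1} {suc (suc k)} (s≤s (s≤s z≤n))))
  (trans (*-zeroʳ (suc (suc k))) (sym (cong (_+ 0) (k>n⇒nCk≡0 {0} {suc k} (s≤s z≤n)))))
absorption (suc n) (suc k) = begin
  suc (suc k) * (suc (suc n) C suc (suc k))                          ≡⟨ cong (suc (suc k) *_) (pascal (suc n) (suc k)) ⟩
  suc (suc k) * (x + y)                                              ≡⟨ lem₁ k x y ⟩
  x + (suc k * x + suc (suc k) * y)                                  ≡⟨ cong (x +_) (cong₂ _+_ (absorption n k) (absorption n (suc k))) ⟩
  x + (suc n * (n C k) + suc n * (n C suc k))                        ≡⟨ cong (x +_) (sym (*-distribˡ-+ (suc n) (n C k) (n C suc k))) ⟩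
  x + suc n * (n C k + n C suc k)                                    ≡⟨ cong (λ z → x + suc n * z) (sym (pascal n k)) ⟩
  suc (suc n) * x                                                    ∎
  where
  open ≡-Reasoning
  x = suc n C suc k
  y = suc n C suc (suc k)
  lem₁ : ∀ k x y → suc (suc k) * (x + y) ≡ x + (suc k * x + suc (suc k) * y)
  lem₁ = solve-∀

-- The summand also receives `R`, the part of `X` outside `A`, so that sums can be nested: the next
-- block is chosen from `R`.
Σ⊆ : ∀ {n} → Subset n → ℕ → (Subset n → Subset n → ℕ) → ℕ
Σ⊆ [] zero h = h [] []
Σ⊆ [] (suc k) h = 0
Σ⊆ (false ∷ X) k h = Σ⊆ X k (λ A R → h (false ∷ A) (false ∷ R))
Σ⊆ (true ∷ X) zero h = Σ⊆ X zero (λ A R → h (false ∷ A) (true ∷ R))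
Σ⊆ (true ∷ X) (suc k) h =
  Σ⊆ X k (λ A R → h (true ∷ A) (false ∷ R)) + Σ⊆ X (suc k) (λ A R → h (false ∷ A) (true ∷ R))

Splits : ∀ {n} → Subset n → ℕ → Subset n → Subset n → Set
Splits X k A R = Sep X A R × ∣ A ∣ ≡ k × k + ∣ R ∣ ≡ ∣ X ∣

+-split-< : ∀ a b {a′ b′} → a + b < a′ + b′ → a < a′ ⊎ b < b′
+-split-< a b {a′} {b′} h with a <? a′
... | yes p = inj₁ p
... | no ¬p with b <? b′
...   | yes q = inj₂ q
...   | no ¬q = contradiction h (≤⇒≯ (+-mono-≤ (≮⇒≥ ¬p) (≮⇒≥ ¬q)))

-- The averaging principle in constructive form: a strict inequality between two sums descends into
-- one of the two branches of the recursion until it reaches a single term.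
Σ⊆-search : ∀ {n} (X : Subset n) k {h h′} → Σ⊆ X k h < Σ⊆ X k h′ →
  ∃ λ A → ∃ λ R → Splits X k A R × h A R < h′ A R
Σ⊆-search [] zero lt = [] , [] , ([] , refl , refl) , lt
Σ⊆-search (false ∷ X) k lt with Σ⊆-search X k lt
... | A , R , (s , e , e′) , lt′ = false ∷ A , false ∷ R , (skip s , e , e′) , lt′
Σ⊆-search (true ∷ X) zero lt with Σ⊆-search X zero lt
... | A , R , (s , e , e′) , lt′ = false ∷ A , true ∷ R , (right s , e , cong suc e′) , lt′
Σ⊆-search (true ∷ X) (suc k) {h} {h′} lt
  with +-split-< (Σ⊆ X k (λ A R → h (true ∷ A) (false ∷ R))) _ lt
... | inj₁ lt₁ with Σ⊆-search X k lt₁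
...   | A , R , (s , e , e′) , lt′ = true ∷ A , false ∷ R , (left s , cong suc e , cong suc e′) , lt′
Σ⊆-search (true ∷ X) (suc k) {h} {h′} lt | inj₂ lt₂ with Σ⊆-search X (suc k) lt₂
...   | A , R , (s , e , e′) , lt′ =
  false ∷ A , true ∷ R , (right s , e , trans (+-suc (suc k) ∣ R ∣) (cong suc e′)) , lt′

Σ⊆-mono : ∀ {n} (X : Subset n) k {h h′} → (∀ A R → Splits X k A R → h A R ≤ h′ A R) →
  Σ⊆ X k h ≤ Σ⊆ X k h′
Σ⊆-mono X k le = ≮⇒≥ λ lt → let A , R , s , lt′ = Σ⊆-search X k lt in <⇒≱ lt′ (le A R s)

Σ⊆-cong : ∀ {n} (X : Subset n) k {h h′} → (∀ A R → Splits X k A R → h A R ≡ h′ A R) →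
  Σ⊆ X k h ≡ Σ⊆ X k h′
Σ⊆-cong X k eq = ≤-antisym (Σ⊆-mono X k λ A R s → ≤-reflexive (eq A R s))
  (Σ⊆-mono X k λ A R s → ≤-reflexive (sym (eq A R s)))

+-interchange : ∀ a b c d → (a + b) + (c + d) ≡ (a + c) + (b + d)
+-interchange = solve-∀

Σ⊆-+ : ∀ {n} (X : Subset n) k h h′ → Σ⊆ X k (λ A R → h A R + h′ A R) ≡ Σ⊆ X k h + Σ⊆ X k h′
Σ⊆-+ [] zero h h′ = refl
Σ⊆-+ [] (suc k) h h′ = refl
Σ⊆-+ (false ∷ X) k h h′ = Σ⊆-+ X k _ _
Σ⊆-+ (true ∷ X) zero h h′ = Σ⊆-+ X zero _ _
Σ⊆-+ (true ∷ X) (suc k) h h′ = trans (cong₂ _+_ (Σ⊆-+ X k _ _) (Σ⊆-+ X (suc k) _ _))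
  (+-interchange (Σ⊆ X k _) (Σ⊆ X k _) (Σ⊆ X (suc k) _) (Σ⊆ X (suc k) _))

Σ⊆-* : ∀ {n} (X : Subset n) k c h → Σ⊆ X k (λ A R → c * h A R) ≡ c * Σ⊆ X k h
Σ⊆-* [] zero c h = refl
Σ⊆-* [] (suc k) c h = sym (*-zeroʳ c)
Σ⊆-* (false ∷ X) k c h = Σ⊆-* X k c _
Σ⊆-* (true ∷ X) zero c h = Σ⊆-* X zero c _
Σ⊆-* (true ∷ X) (suc k) c h = trans (cong₂ _+_ (Σ⊆-* X k c _) (Σ⊆-* X (suc k) c _))
  (sym (*-distribˡ-+ c _ _))

Σ⊆-const : ∀ {n} (X : Subset n) k c → Σ⊆ X k (λ _ _ → c) ≡ (∣ X ∣ C k) * c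
Σ⊆-const [] zero c = sym (trans (cong (_* c) (nC0≡1 0)) (+-identityʳ c))
Σ⊆-const [] (suc k) c = sym (cong (_* c) (k>n⇒nCk≡0 {0} {suc k} (s≤s z≤n)))
Σ⊆-const (false ∷ X) k c = Σ⊆-const X k c
Σ⊆-const (true ∷ X) zero c =
  trans (Σ⊆-const X zero c) (cong (_* c) (trans (nC0≡1 ∣ X ∣) (sym (nC0≡1 (suc ∣ X ∣)))))
Σ⊆-const (true ∷ X) (suc k) c = begin
  Σ⊆ X k (λ _ _ → c) + Σ⊆ X (suc k) (λ _ _ → c)        ≡⟨ cong₂ _+_ (Σ⊆-const X k c) (Σ⊆-const X (suc k) c) ⟩
  (∣ X ∣ C k) * c + (∣ X ∣ C suc k) * c                ≡⟨ sym (*-distribʳ-+ c (∣ X ∣ C k) _) ⟩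
  (∣ X ∣ C k + ∣ X ∣ C suc k) * c                      ≡⟨ cong (_* c) (sym (pascal ∣ X ∣ k)) ⟩
  (suc ∣ X ∣ C suc k) * c                              ∎
  where open ≡-Reasoning

-- Double counting: both sides range over ordered pairs of disjoint subsets of `X`.
Σ⊆-swap : ∀ {n} (X : Subset n) k l (h : Subset n → Subset n → ℕ) →
  Σ⊆ X k (λ A R → Σ⊆ R l (λ B _ → h A B)) ≡ Σ⊆ X l (λ B R → Σ⊆ R k (λ A _ → h A B))
Σ⊆-swap [] zero zero h = refl
Σ⊆-swap [] zero (suc l) h = refl
Σ⊆-swap [] (suc k) zero h = refl
Σ⊆-swap [] (suc k) (suc l) h = refl
Σ⊆-swap (false ∷ X) k l h = Σ⊆-swap X k l _
Σ⊆-swap (true ∷ X) zero zero h = Σ⊆-swap X zero zero _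
Σ⊆-swap (true ∷ X) zero (suc l) h =
  trans (Σ⊆-+ X zero _ _) (cong₂ _+_ (Σ⊆-swap X zero l _) (Σ⊆-swap X zero (suc l) _))
Σ⊆-swap (true ∷ X) (suc k) zero h =
  sym (trans (Σ⊆-+ X zero _ _) (cong₂ _+_ (sym (Σ⊆-swap X k zero _)) (sym (Σ⊆-swap X (suc k) zero _))))
Σ⊆-swap (true ∷ X) (suc k) (suc l) h = begin
  a + Σ⊆ X (suc k) (λ A R → b A R + c A R)      ≡⟨ cong (a +_) (Σ⊆-+ X (suc k) b c) ⟩
  a + (Σ⊆ X (suc k) b + Σ⊆ X (suc k) c)         ≡⟨ cong₂ _+_ (Σ⊆-swap X k (suc l) _)
                                                     (cong₂ _+_ (Σ⊆-swap X (suc k) l _) (Σ⊆-swap X (suc k) (suc l) _)) ⟩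
  a′ + (b′ + c′)                                ≡⟨ x∙yz≈y∙xz a′ b′ c′ ⟩
  b′ + (a′ + c′)                                ≡⟨ cong (b′ +_) (sym (Σ⊆-+ X (suc l) _ _)) ⟩
  _                                             ∎
  where
  open ≡-Reasoning
  x∙yz≈y∙xz : ∀ a b c → a + (b + c) ≡ b + (a + c)
  x∙yz≈y∙xz = solve-∀
  a = Σ⊆ X k (λ A R → Σ⊆ R (suc l) (λ B _ → h (true ∷ A) (false ∷ B)))
  b = λ A R → Σ⊆ R l (λ B _ → h (false ∷ A) (true ∷ B))
  c = λ A R → Σ⊆ R (suc l) (λ B _ → h (false ∷ A) (false ∷ B))
  a′ = Σ⊆ X (suc l) (λ B R → Σ⊆ R k (λ A _ → h (true ∷ A) (false ∷ B)))
  b′ = Σ⊆ X l (λ B R → Σ⊆ R (suc k) (λ A _ → h (false ∷ A) (true ∷ B)))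
  c′ = Σ⊆ X (suc l) (λ B R → Σ⊆ R (suc k) (λ A _ → h (false ∷ A) (false ∷ B)))

miss : Bool → ℕ
miss b = if not b then 1 else 0

-- The index `r` is an allowance rather than a count: `nil` accepts any remainder, which
-- `partitionPacks` converts into sets inside the front.
data Partition {n} (F : Subset n → Bool) (m : ℕ) : ℕ → Subset n → ℕ → Set where
  nil  : ∀ {r X} → Partition F m r X 0
  good : ∀ {r X A R p} → Sep X A R → ∣ A ∣ ≡ m → F A ≡ true → Partition F m r R p → Partition F m r X (suc p)
  bad  : ∀ {r X A R p} → Sep X A R → ∣ A ∣ ≡ m → Partition F m r R p → Partition F m (suc r) X (suc p)

missing : ∀ {n} → (Subset n → Bool) → ℕ → Subset n → ℕ
missing F m X = Σ⊆ X m (λ A _ → miss (F A))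

-- C(pm, m), with the value at p = 0 replaced by 1 so that it can be cancelled.
blocks : ℕ → ℕ → ℕ
blocks m zero = 1
blocks m (suc p) = (suc p * m) C m

blocks>0 : ∀ m p → 1 ≤ blocks m p
blocks>0 m zero = ≤-refl
blocks>0 m (suc p) = nCk>0 (m≤m+n m (p * m))

p*C≤p*blocks : ∀ m p → p * ((p * m) C m) ≤ p * blocks m p
p*C≤p*blocks m zero = z≤n
p*C≤p*blocks m (suc p) = ≤-refl

-- A missing set `B` lies in the rest exactly when the first block is an m-subset of the remaining
-- pm points, so it is counted C(pm, m) times.
Σ⊆-missing-rest : ∀ {n} (F : Subset n → Bool) m p (X : Subset n) → ∣ X ∣ ≡ suc p * m →
  p * Σ⊆ X m (λ _ R → missing F m R) ≤ blocks m p * (p * missing F m X)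
Σ⊆-missing-rest F m p X e = begin
  p * Σ⊆ X m (λ _ R → missing F m R)                     ≡⟨ cong (p *_) (Σ⊆-swap X m m (λ _ B → miss (F B))) ⟩
  p * Σ⊆ X m (λ B R → Σ⊆ R m (λ _ _ → miss (F B)))       ≡⟨ cong (p *_) (Σ⊆-cong X m count) ⟩
  p * Σ⊆ X m (λ B R → ((p * m) C m) * miss (F B))        ≡⟨ cong (p *_) (Σ⊆-* X m ((p * m) C m) _) ⟩
  p * (((p * m) C m) * missing F m X)                    ≡⟨ sym (*-assoc p _ _) ⟩
  p * ((p * m) C m) * missing F m X                      ≤⟨ *-monoˡ-≤ (missing F m X) (p*C≤p*blocks m p) ⟩
  p * blocks m p * missing F m X                         ≡⟨ lem p (blocks m p) (missing F m X) ⟩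
  blocks m p * (p * missing F m X)                       ∎
  where
  open ≤-Reasoning
  count : ∀ B R → Splits X m B R → Σ⊆ R m (λ _ _ → miss (F B)) ≡ ((p * m) C m) * miss (F B)
  count B R (_ , _ , e′) = trans (Σ⊆-const R m _)
    (cong (λ z → (z C m) * miss (F B)) (+-cancelˡ-≡ m _ _ (trans e′ e)))
  lem : ∀ p b x → p * b * x ≡ b * (p * x)
  lem = solve-∀

-- In a uniformly random partition of X into p blocks the expected number of missing blocks is
-- p · missing / C(pm, m); the first block is chosen by averaging and the rest by induction.
partition : ∀ {n} (F : Subset n → Bool) m p r (X : Subset n) → ∣ X ∣ ≡ p * m →
  p * missing F m X < suc r * blocks m p → Partition F m r X p
partition F m zero r X e lt = nil
partition F m (suc p) r X e lt = choose (Σ⊆-search X m total<)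
  where
  V = blocks m p
  instance _ = >-nonZero (blocks>0 m p)
  total< : Σ⊆ X m (λ A R → p * missing F m R + V * miss (F A)) < Σ⊆ X m (λ _ _ → suc r * V)
  -- Everything is measured in units of `V`: a missing first block weighs `V`, and
  -- `p * missing F m R` is `V` times the expected number of missing blocks in the rest.
  total< = begin-strict
    Σ⊆ X m (λ A R → p * missing F m R + V * miss (F A))  ≡⟨ Σ⊆-+ X m _ _ ⟩
    Σ⊆ X m (λ A R → p * missing F m R) + Σ⊆ X m (λ A R → V * miss (F A))
      ≡⟨ cong₂ _+_ (Σ⊆-* X m p _) (Σ⊆-* X m V _) ⟩
    p * Σ⊆ X m (λ A R → missing F m R) + V * missing F m X
      ≤⟨ +-monoˡ-≤ _ (Σ⊆-missing-rest F m p X e) ⟩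
    V * (p * missing F m X) + V * missing F m X          ≡⟨ lem V p (missing F m X) ⟩
    suc p * missing F m X * V                            <⟨ *-monoˡ-< V lt ⟩
    suc r * ((suc p * m) C m) * V                        ≡⟨ lem′ (suc r) ((suc p * m) C m) V ⟩
    ((suc p * m) C m) * (suc r * V)                      ≡⟨ cong (λ z → (z C m) * (suc r * V)) (sym e) ⟩
    (∣ X ∣ C m) * (suc r * V)                            ≡⟨ sym (Σ⊆-const X m _) ⟩
    Σ⊆ X m (λ _ _ → suc r * V)                           ∎
    where
    open ≤-Reasoning
    lem : ∀ v p x → v * (p * x) + v * x ≡ suc p * x * v
    lem = solve-∀
    lem′ : ∀ r x v → r * x * v ≡ x * (r * v)
    lem′ = solve-∀
  choose : (∃ λ A → ∃ λ R → Splits X m A R × p * missing F m R + V * miss (F A) < suc r * V) →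
    Partition F m r X (suc p)
  choose (A , R , (s , ea , er) , lt′) with F A in FA
  ... | true = good s ea FA (partition F m p r R (+-cancelˡ-≡ m _ _ (trans er e))
    (≤-<-trans (m≤m+n _ _) lt′))
  ... | false = spend r lt′
    where
    spend : ∀ r → p * missing F m R + V * 1 < suc r * V → Partition F m r X (suc p)
    -- With no allowance left the first block cannot be missing, since its weight `V` alone reaches
    -- the bound.
    spend zero lt″ = contradiction lt″ (≤⇒≯ (≤-trans (≤-reflexive (*-comm 1 V)) (m≤n+m _ _)))
    spend (suc r) lt″ = bad s ea (partition F m p r R (+-cancelˡ-≡ m _ _ (trans er e))
      (+-cancelʳ-< V _ _ (subst₂ _<_ (cong (p * missing F m R +_) (*-identityʳ V)) (+-comm V _) lt″)))

sumAll : ∀ n → (Subset n → ℕ) → ℕ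
sumAll zero q = q []
sumAll (suc n) q = sumAll n (q ∘ (true ∷_)) + sumAll n (q ∘ (false ∷_))

countTrue-++ : ∀ {A : Set} (p : A → Bool) xs ys → countTrue p (xs ++ᴸ ys) ≡ countTrue p xs + countTrue p ys
countTrue-++ p [] ys = refl
countTrue-++ p (x ∷ xs) ys = trans (cong ((if p x then 1 else 0) +_) (countTrue-++ p xs ys)) (sym (+-assoc (if p x then 1 else 0) _ _))

countTrue-map : ∀ {A B : Set} (p : B → Bool) (f : A → B) xs → countTrue p (map f xs) ≡ countTrue (p ∘ f) xs
countTrue-map p f [] = refl
countTrue-map p f (x ∷ xs) = cong ((if p (f x) then 1 else 0) +_) (countTrue-map p f xs)

complementSize≡ : ∀ {n} (F : Family n) → complementSize F ≡ sumAll n (miss ∘ F)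
complementSize≡ {zero} F = +-identityʳ _
complementSize≡ {suc n} F = trans (countTrue-++ _ (map (true ∷_) (allSubsets n)) _) (cong₂ _+_
  (trans (countTrue-map _ _ (allSubsets n)) (complementSize≡ (F ∘ (true ∷_))))
  (trans (countTrue-map _ _ (allSubsets n)) (complementSize≡ (F ∘ (false ∷_)))))

sumAll-++ : ∀ a {b} (q : Subset (a + b) → ℕ) → sumAll (a + b) q ≡ sumAll a (λ A → sumAll b (λ B → q (A ++ B)))
sumAll-++ zero q = refl
sumAll-++ (suc a) q = cong₂ _+_ (sumAll-++ a _) (sumAll-++ a _)

sumAll-mono : ∀ n {q q′ : Subset n → ℕ} → (∀ A → q A ≤ q′ A) → sumAll n q ≤ sumAll n q′
sumAll-mono zero h = h []
sumAll-mono (suc n) h = +-mono-≤ (sumAll-mono n (h ∘ (true ∷_))) (sumAll-mono n (h ∘ (false ∷_)))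

term≤sumAll : ∀ n (q : Subset n → ℕ) A → q A ≤ sumAll n q
term≤sumAll zero q [] = ≤-refl
term≤sumAll (suc n) q (true ∷ A) = ≤-trans (term≤sumAll n (q ∘ (true ∷_)) A) (m≤m+n _ _)
term≤sumAll (suc n) q (false ∷ A) = ≤-trans (term≤sumAll n (q ∘ (false ∷_)) A) (m≤n+m _ _)

Σ⊆≤sumAll : ∀ {n} (X : Subset n) k (q : Subset n → ℕ) → Σ⊆ X k (λ A _ → q A) ≤ sumAll n q
Σ⊆≤sumAll [] zero q = ≤-refl
Σ⊆≤sumAll [] (suc k) q = z≤n
Σ⊆≤sumAll (false ∷ X) k q = ≤-trans (Σ⊆≤sumAll X k _) (m≤n+m _ _)
Σ⊆≤sumAll (true ∷ X) zero q = ≤-trans (Σ⊆≤sumAll X zero _) (m≤n+m _ _)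
Σ⊆≤sumAll (true ∷ X) (suc k) q = +-mono-≤ (Σ⊆≤sumAll X k _) (Σ⊆≤sumAll X (suc k) _)

C-suc-p*m : ∀ m p → (suc p * suc m) C suc m ≡ suc p * ((suc p * suc m ∸ 1) C m)
C-suc-p*m m p = *-cancelˡ-≡ _ _ (suc m)
  (trans (absorption (m + p * suc m) m) (lem m p ((m + p * suc m) C m)))
  where
  lem : ∀ m p x → suc (m + p * suc m) * x ≡ suc m * (suc p * x)
  lem = solve-∀

-- By absorption C(pm, m) = p C(pm - 1, m - 1), so the expected number of missing blocks is the
-- number of missing m-sets divided by C(pm - 1, m - 1). With r = 2c + 2 this produces the factor 2c
-- + 3 of the bound.
partition′ : ∀ {n} (F : Subset n → Bool) m p r (X : Subset n) → ∣ X ∣ ≡ suc p * suc m →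
  missing F (suc m) X < suc r * ((suc p * suc m ∸ 1) C m) → Partition F (suc m) r X (suc p)
partition′ F m p r X e lt = partition F (suc m) (suc p) r X e (begin-strict
  suc p * missing F (suc m) X                    <⟨ *-monoʳ-< (suc p) lt ⟩
  suc p * (suc r * ((suc p * suc m ∸ 1) C m))    ≡⟨ lem (suc p) (suc r) _ ⟩
  suc r * (suc p * ((suc p * suc m ∸ 1) C m))    ≡⟨ cong (suc r *_) (sym (C-suc-p*m m p)) ⟩
  suc r * ((suc p * suc m) C suc m)              ∎)
  where
  open ≤-Reasoning
  lem : ∀ a b c → a * (b * c) ≡ b * (a * c)
  lem = solve-∀

-- The tail family

sumAll-⊥+singles : ∀ {n y} (q : Subset n → ℕ) → y ≤ q ⊥ → (∀ A → ∣ A ∣ ≡ 1 → 1 ≤ q A) → y + n ≤ sumAll n q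
sumAll-⊥+singles {zero} {y} q h₀ h₁ = ≤-trans (≤-reflexive (+-identityʳ y)) h₀
sumAll-⊥+singles {suc n} {y} q h₀ h₁ = ≤-trans (≤-reflexive (+-suc y n))
  (+-mono-≤ {1} (≤-trans (h₁ (true ∷ ⊥) (cong suc (∣⊥∣≡0 n))) (term≤sumAll _ (q ∘ (true ∷_)) ⊥))
    (sumAll-⊥+singles (q ∘ (false ∷_)) h₀ (h₁ ∘ (false ∷_))))

-- The weights `y` and `x` allow `q` to be an inner sum over a further stretch of points, where ⊥
-- and one chosen singleton contribute several missing sets each.
sumAll-⊥+singles+ : ∀ {n y x} (q : Subset n → ℕ) → y ≤ q ⊥ → (∀ A → ∣ A ∣ ≡ 1 → 1 ≤ q A) →
  ∀ L → ∣ L ∣ ≡ 1 → suc x ≤ q L → y + n + x ≤ sumAll n q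
sumAll-⊥+singles+ {suc n} {y} {x} q h₀ h₁ (true ∷ L) e hL = ≤-trans (≤-reflexive (lem y n x))
  (+-mono-≤ (≤-trans (subst (λ P → suc x ≤ q (true ∷ P)) (∣p∣≡0⇒p≡⊥ L (cong pred e)) hL)
      (term≤sumAll _ (q ∘ (true ∷_)) ⊥))
    (sumAll-⊥+singles (q ∘ (false ∷_)) h₀ (h₁ ∘ (false ∷_))))
  where
  lem : ∀ y n x → y + suc n + x ≡ suc x + (y + n)
  lem = solve-∀
sumAll-⊥+singles+ {suc n} {y} {x} q h₀ h₁ (false ∷ L) e hL = ≤-trans (≤-reflexive (cong (_+ x) (+-suc y n)))
  (+-mono-≤ {1} (≤-trans (h₁ (true ∷ ⊥) (cong suc (∣⊥∣≡0 n))) (term≤sumAll _ (q ∘ (true ∷_)) ⊥))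
    (sumAll-⊥+singles+ (q ∘ (false ∷_)) h₀ (h₁ ∘ (false ∷_)) L e hL))

⊥+term≤sumAll : ∀ {n} (q : Subset n → ℕ) A → 1 ≤ ∣ A ∣ → q ⊥ + q A ≤ sumAll n q
⊥+term≤sumAll q (true ∷ A) h = ≤-trans (≤-reflexive (+-comm (q ⊥) _))
  (+-mono-≤ (term≤sumAll _ (q ∘ (true ∷_)) A) (term≤sumAll _ (q ∘ (false ∷_)) ⊥))
⊥+term≤sumAll q (false ∷ A) h = ≤-trans (⊥+term≤sumAll (q ∘ (false ∷_)) A h) (m≤n+m _ _)

sumAll-⊥+singles+large : ∀ {n} (q : Subset n → ℕ) → 1 ≤ q ⊥ → (∀ A → ∣ A ∣ ≡ 1 → 1 ≤ q A) →
  ∀ B → 2 ≤ ∣ B ∣ → 1 ≤ q B → 2 + n ≤ sumAll n q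
sumAll-⊥+singles+large {suc n} q h₀ h₁ (true ∷ B) (s≤s h) hB =
  +-mono-≤ {2} (≤-trans (+-mono-≤ (h₁ (true ∷ ⊥) (cong suc (∣⊥∣≡0 n))) hB) (⊥+term≤sumAll (q ∘ (true ∷_)) B h))
    (sumAll-⊥+singles (q ∘ (false ∷_)) h₀ (h₁ ∘ (false ∷_)))
sumAll-⊥+singles+large {suc n} q h₀ h₁ (false ∷ B) h hB =
  +-mono-≤ {1} (≤-trans (h₁ (true ∷ ⊥) (cong suc (∣⊥∣≡0 n))) (term≤sumAll _ (q ∘ (true ∷_)) ⊥))
    (sumAll-⊥+singles+large (q ∘ (false ∷_)) h₀ (h₁ ∘ (false ∷_)) B h hB)

data TailPack {t} (g : Subset t → Bool) : Subset t → ℕ → Set where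
  nil  : ∀ {Z} → TailPack g Z 0
  cons : ∀ {Z S Z′ j} → Sep Z S Z′ → g S ≡ true → TailPack g Z′ j → TailPack g Z (suc j)

tailPack-⊤ : ∀ {t} {g : Subset t → Bool} {Z j} → TailPack g Z j → TailPack g ⊤ j
tailPack-⊤ nil = nil
tailPack-⊤ (cons s gS T) = cons (sep-⊤ s) gS T

tailPack-singles : ∀ {z d j} {g : Subset (z + d) → Bool} (W : Subset d) →
  (∀ A → ∣ A ∣ ≡ 1 → g (A ++ ⊥) ≡ true) → (∀ Z → TailPack g (Z ++ W) j) →
  ∀ k Z → k ≤ ∣ Z ∣ → TailPack g (Z ++ W) (k + j)
tailPack-singles W present rest zero Z h = rest Z
tailPack-singles W present rest (suc k) Z h with sep-choose 1 k Z h
... | A , Z′ , s , e , h′ =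
  cons (sep-++ s (sep-⊥ˡ W)) (present A e) (tailPack-singles W present rest k Z′ h′)

tailPack-matching : ∀ {z e y} {g : Subset (z + (e + (e + y))) → Bool} (Z : Subset z) (W : Subset y) →
  (∀ (A : Subset e) → ∣ A ∣ ≡ 1 → g (⊥ {z} ++ (A ++ (A ++ ⊥))) ≡ true) →
  ∀ k (E : Subset e) → k ≤ ∣ E ∣ → TailPack g (Z ++ (E ++ (E ++ W))) k
tailPack-matching Z W present zero E h = nil
tailPack-matching {z} {e} {y} Z W present (suc k) E h with sep-choose 1 k E h
... | A , E′ , s , eA , h′ =
  cons (sep-++ (sep-⊥ˡ Z) (sep-++ s (sep-++ s (sep-⊥ˡ W)))) (present A eA)
    (tailPack-matching {z} {e} {y} Z W present k E′ h′)

tailPack-pairs : ∀ {d} {g : Subset (suc d) → Bool} → (∀ B → ∣ B ∣ ≡ 2 → g (false ∷ B) ≡ true) →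
  ∀ k b Z → k * 2 ≤ ∣ Z ∣ → TailPack g (b ∷ Z) k
tailPack-pairs present zero b Z h = nil
tailPack-pairs present (suc k) b Z h with sep-choose 2 (k * 2) Z h
... | B , Z′ , s , e , h′ = cons (skip s) (present B e) (tailPack-pairs present k false Z′ h′)

data Cut : ∀ {t} → (Subset t → Bool) → Set where
  cut : ∀ z d {g : Subset (z + d) → Bool} →
    (∀ (A : Subset z) → ∣ A ∣ ≡ 1 → g (A ++ ⊥) ≡ true) →
    (∀ (B : Subset d) → ∣ B ∣ ≡ 1 → g (⊥ ++ B) ≡ false) → Cut g

-- A singleton can be shifted to any earlier one, so the present singletons form an initial segment.
findCut : ∀ {t} (g : Subset t → Bool) → DomClosed g → Cut g
findCut {zero} g cl = cut 0 0 (λ { [] () }) (λ { [] () })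
findCut {suc t} g cl with g (true ∷ ⊥) in e
... | false = cut 0 (suc t) (λ { [] () }) λ B eB →
  domClosed-false cl (dom-slack-single B eB) e
  where
  dom-slack-single : ∀ {t} (B : Subset (suc t)) → ∣ B ∣ ≡ 1 → Dom 0 0 B (true ∷ ⊥)
  dom-slack-single {t} B eB = dom-initial 0 0 1 B (s≤s z≤n) (sym eB)
... | true with findCut (g ∘ (false ∷_)) (λ d → cl (same d))
...   | cut z d present absent = cut (suc z) d present′ absent
  where
  present′ : ∀ A → ∣ A ∣ ≡ 1 → g (A ++ ⊥) ≡ true
  present′ (true ∷ A) eA = trans (cong (g ∘ (true ∷_))
    (trans (cong (_++ ⊥) (∣p∣≡0⇒p≡⊥ A (cong pred eA))) (⊥-++ z))) e
  present′ (false ∷ A) eA = present A eA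

-- The last two cases provide only 1 + c of the 2 + c tail sets: in `Q-type` the first singleton and
-- c pairs among the other 2c + 1 points, in `W-type` two singletons. A member outside Q or W has to
-- supply one more.
data TailType (c : ℕ) : ∀ {t} → (Subset t → Bool) → Set where
  empty  : ∀ {t} {g : Subset t → Bool} → g ⊥ ≡ true → TailType c g
  packed : ∀ {t} {g : Subset t → Bool} A → ∣ A ∣ ≡ 1 → g A ≡ true → TailPack g ⊤ (2 + c) → TailType c g
  Q-type : ∀ {d} {g : Subset (suc d) → Bool} → g (true ∷ ⊥) ≡ true →
    (∀ B → ∣ B ∣ ≡ 2 → g (false ∷ B) ≡ true) → TailType c g
  W-type : ∀ {d} {g : Subset (2 + d) → Bool} → c ≡ 1 → g (true ∷ false ∷ ⊥) ≡ true →
    TailPack g (true ∷ true ∷ ⊥) 2 → TailType c g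

last-singleton : ∀ n → ∃ λ (L : Subset (suc n)) → ∣ L ∣ ≡ 1 × (∀ D → ∣ D ∣ ≡ 1 → Dom 0 0 L D)
last-singleton zero = true ∷ [] , refl , λ { (true ∷ []) _ → same [] }
last-singleton (suc n) with last-singleton n
... | L , e , dom = false ∷ L , e , dom′
  where
  dom′ : ∀ D → ∣ D ∣ ≡ 1 → Dom 0 0 (false ∷ L) D
  dom′ (true ∷ D) eD = up (dom-slack 1 0 L D (≤-reflexive e) (trans eD (sym e)))
  dom′ (false ∷ D) eD = same (dom D eD)

-- The pair consists of the first and the last point. The surplus 1, a point preceding this stretch,
-- pays for the first, and the last is at least any element of `D`.
spread-pair : ∀ n → 2 ≤ n → ∃ λ (B : Subset n) → ∣ B ∣ ≡ 2 × (∀ D → ∣ D ∣ ≡ 1 → Dom 1 0 B D)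
spread-pair (suc (suc n)) h with last-singleton n
... | L , e , dom = true ∷ L , cong suc e , dom′
  where
  dom′ : ∀ D → ∣ D ∣ ≡ 1 → Dom 1 0 (true ∷ L) D
  dom′ (true ∷ D) eD = same (dom-slack 1 0 L D (≤-reflexive e) (trans eD (sym e)))
  dom′ (false ∷ D) eD = down (dom D eD)
spread-pair (suc zero) (s≤s ())

false⇒miss : ∀ {b} → b ≡ false → 1 ≤ miss b
false⇒miss refl = ≤-refl

-- If {v_i, v_{e+i}} is missing then so are {v_i, v_b} for b ≥ 2e, and also {v_{e+1}, v_{2e+y}}.
missing-pair-count : ∀ {z e y} (g : Subset (z + (e + (e + y))) → Bool) → DomClosed g → 2 ≤ e + y →
  g ⊥ ≡ false → (∀ (B : Subset (e + (e + y))) → ∣ B ∣ ≡ 1 → g (⊥ {z} ++ B) ≡ false) →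
  ∀ (A : Subset e) → ∣ A ∣ ≡ 1 → g (⊥ {z} ++ (A ++ (A ++ ⊥))) ≡ false →
  2 + (e + y) + e + suc y ≤ sumAll (z + (e + (e + y))) (miss ∘ g)
missing-pair-count {z} {e} {y} g cl 2≤ g⊥ absent A eA gA = begin
  2 + (e + y) + e + suc y                              ≤⟨ sumAll-⊥+singles+ φ φ⊥ φ₁ A eA φA ⟩
  sumAll e φ                                           ≡⟨ sym (sumAll-++ e q) ⟩
  sumAll (e + (e + y)) q                               ≤⟨ term≤sumAll z _ ⊥ ⟩
  sumAll z (λ P → sumAll (e + (e + y)) (λ B → miss (g (P ++ B))))   ≡⟨ sym (sumAll-++ z (miss ∘ g)) ⟩
  sumAll (z + (e + (e + y))) (miss ∘ g)                ∎
  where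
  open ≤-Reasoning
  q : Subset (e + (e + y)) → ℕ
  q B = miss (g (⊥ {z} ++ B))
  φ : Subset e → ℕ
  φ P = sumAll (e + y) (λ B → q (P ++ B))
  single : ∀ B → ∣ B ∣ ≡ 1 → 1 ≤ q B
  single B eB = false⇒miss (absent B eB)
  above : ∀ B → Dom 0 0 B (A ++ (A ++ ⊥)) → 1 ≤ q B
  above B d = false⇒miss (domClosed-false cl (dom-++ (dom-refl (⊥ {z})) d) gA)
  ∣⊥++∣ : ∀ (B : Subset (e + y)) → ∣ B ∣ ≡ 1 → ∣ ⊥ {e} ++ B ∣ ≡ 1
  ∣⊥++∣ B eB = trans (∣++∣ (⊥ {e}) B) (trans (cong (_+ ∣ B ∣) (∣⊥∣≡0 e)) eB)
  ∣A++⊥∣ : ∀ b (P : Subset e) → ∣ P ∣ ≡ 1 → ∣ P ++ ⊥ {b} ∣ ≡ 1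
  ∣A++⊥∣ b P eP = trans (∣++∣ P ⊥) (cong₂ _+_ eP (∣⊥∣≡0 b))
  φ⊥ : 2 + (e + y) ≤ φ ⊥
  φ⊥ with spread-pair (e + y) 2≤
  ... | B , eB , dom = sumAll-⊥+singles+large (λ B → q (⊥ {e} ++ B))
    (false⇒miss (trans (cong g (trans (cong (⊥ {z} ++_) (⊥-++ e {e + y})) (⊥-++ z))) g⊥))
    (λ D eD → single (⊥ {e} ++ D) (∣⊥++∣ D eD)) B (≤-reflexive (sym eB))
    (above (⊥ {e} ++ B) (dom-++ (subst (λ k → Dom 0 k ⊥ A) eA (dom-⊥ˡ 0 A)) (dom (A ++ ⊥) (∣A++⊥∣ y A eA))))
  φ₁ : ∀ P → ∣ P ∣ ≡ 1 → 1 ≤ φ P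
  φ₁ P eP = ≤-trans (single (P ++ ⊥) (∣A++⊥∣ (e + y) P eP)) (term≤sumAll (e + y) _ ⊥)
  φA : 2 + y ≤ φ A
  φA = begin
    2 + y                                                          ≡⟨ +-comm 1 (suc y) ⟩
    suc y + 1                                                      ≤⟨ +-mono-≤ φA⊥ φAA ⟩
    ψ ⊥ + ψ A                                                      ≤⟨ ⊥+term≤sumAll ψ A (≤-reflexive (sym eA)) ⟩
    sumAll e ψ                                                     ≡⟨ sym (sumAll-++ e (λ B → q (A ++ B))) ⟩
    φ A                                                            ∎
    where
    ψ : Subset e → ℕ
    ψ P = sumAll y (λ B → q (A ++ (P ++ B)))
    φA⊥ : suc y ≤ ψ ⊥
    φA⊥ = sumAll-⊥+singles (λ B → q (A ++ (⊥ {e} ++ B)))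
      (subst (λ P → 1 ≤ q (A ++ P)) (sym (⊥-++ e)) (single (A ++ ⊥) (∣A++⊥∣ (e + y) A eA)))
      (λ D eD → above (A ++ (⊥ {e} ++ D)) (dom-++ (dom-refl A) (dom-++ {k′ = 1}
        (subst (λ k → Dom 0 k ⊥ A) eA (dom-⊥ˡ 0 A))
        (dom-slack 1 0 D ⊥ (≤-reflexive eD) (trans (cong suc (∣⊥∣≡0 y)) (sym eD))))))
    φAA : 1 ≤ ψ A
    φAA = ≤-trans (above (A ++ (A ++ ⊥)) (dom-refl _)) (term≤sumAll y _ ⊥)

classify-matching : ∀ z e (g : Subset (2 + z + (e + (e + z))) → Bool) → 1 ≤ e → DomClosed g →
  sumAll _ (miss ∘ g) < 3 + 2 * (e + z) → g ⊥ ≡ false →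
  (∀ (A : Subset (2 + z)) → ∣ A ∣ ≡ 1 → g (A ++ ⊥) ≡ true) →
  (∀ (B : Subset (e + (e + z))) → ∣ B ∣ ≡ 1 → g (⊥ {2 + z} ++ B) ≡ false) → TailType (e + z) g
classify-matching z e g 1≤e cl few g⊥ present absent with 2 ≤? e + z
... | yes 2≤ = packed _ ∣first∣ first
  (subst (TailPack g ⊤) (cong (2 +_) (+-comm z e)) (tailPack-⊤
    (tailPack-singles {2 + z} (⊤ {e} ++ (⊤ {e} ++ ⊤ {z})) present
      (λ Z → tailPack-matching {2 + z} {e} {z} Z ⊤ pair e ⊤ (≤-reflexive (sym (∣⊤∣≡n e))))
      (2 + z) ⊤ (≤-reflexive (sym (∣⊤∣≡n (2 + z)))))))
  where
  ∣first∣ : ∣ (true ∷ ⊥ {1 + z}) ++ ⊥ {e + (e + z)} ∣ ≡ 1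
  ∣first∣ = trans (∣++∣ (true ∷ ⊥ {1 + z}) ⊥) (cong₂ _+_ (cong suc (∣⊥∣≡0 z)) (∣⊥∣≡0 (e + (e + z))))
  first = present (true ∷ ⊥) (cong suc (∣⊥∣≡0 z))
  pair : ∀ (A : Subset e) → ∣ A ∣ ≡ 1 → g (⊥ {2 + z} ++ (A ++ (A ++ ⊥))) ≡ true
  pair A eA with g (⊥ {2 + z} ++ (A ++ (A ++ ⊥))) in gA
  ... | true = refl
  ... | false = contradiction few (≤⇒≯ (≤-trans (≤-reflexive (lem e z))
    (missing-pair-count {2 + z} g cl 2≤ g⊥ absent A eA gA)))
    where
    lem : ∀ e z → 3 + 2 * (e + z) ≡ 2 + (e + z) + e + suc z
    lem = solve-∀
classify-matching zero (suc zero) g 1≤e cl few g⊥ present absent | no _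
  -- For c = 1 the matching is the single pair of absent singletons. If it is missing too, then with
  -- ⊥ and both singletons only 4 = 2c + 2 sets are missing, which the hypothesis permits: this is
  -- the pattern of W.
  with g (false ∷ false ∷ true ∷ true ∷ []) in gpair
... | true = packed _ refl (present (true ∷ false ∷ []) refl)
  (cons (left (right (right (right [])))) (present (true ∷ false ∷ []) refl)
    (cons (skip (left (right (right [])))) (present (false ∷ true ∷ []) refl)
      (cons (skip (skip (left (left [])))) gpair nil)))
... | false = W-type refl (present (true ∷ false ∷ []) refl)
  (cons (left (right (skip (skip [])))) (present (true ∷ false ∷ []) refl)
    (cons (skip (left (skip (skip [])))) (present (false ∷ true ∷ []) refl) nil))
classify-matching (suc z) (suc zero) g 1≤e cl few g⊥ present absent | no ¬2≤ = contradiction (s≤s (s≤s z≤n)) ¬2≤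
classify-matching z (suc (suc e)) g 1≤e cl few g⊥ present absent | no ¬2≤ = contradiction (s≤s (s≤s z≤n)) ¬2≤

-- With `2 + z` present singletons, `e = d − c` members are lacking for a total of `2 + c`. The
-- `d = e + (e + z)` points of absent singletons have room for `e` disjoint pairs, with `z` points
-- wasted.
half-split : ∀ z d c → z + d ≡ 2 * c → c < d → ∃ λ e → 1 ≤ e × c ≡ e + z × d ≡ e + (e + z)
half-split z d c eq c<d with m≤n⇒∃[o]m+o≡n c<d
... | e , refl = suc e , s≤s z≤n , c≡ , trans (cong (λ x → suc x + e) c≡) (lem₂ e z)
  where
  lem₁ : ∀ e z c → suc e + z + c ≡ z + (suc c + e)
  lem₁ = solve-∀
  lem₂ : ∀ e z → suc (suc e + z) + e ≡ suc e + (suc e + z)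
  lem₂ = solve-∀
  c≡ : c ≡ suc e + z
  c≡ = sym (+-cancelʳ-≡ c _ _ (trans (lem₁ e z c) (trans eq (cong (c +_) (+-identityʳ c)))))

-- The cases follow the number of present singletons when ⊥ is missing. With none, ⊥ and the
-- singletons are already 2c + 3 missing sets. With one, they exhaust the allowance 2c + 2, so every
-- pair is present. With more, singletons alone suffice when at most c are absent, and otherwise
-- they are supplemented by a matching.
classify : ∀ {t} c (g : Subset t → Bool) → t ≡ 2 + 2 * c → 1 ≤ c → DomClosed g →
  sumAll t (miss ∘ g) < 3 + 2 * c → TailType c g
classify {t} c g et 1≤c cl few with g ⊥ in g⊥
... | true = empty g⊥
... | false with findCut g cl
... | cut zero d _ absent = contradiction few (≤⇒≯ (≤-trans (≤-reflexive (cong suc (sym et)))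
  (sumAll-⊥+singles (miss ∘ g) (false⇒miss g⊥) (λ B eB → false⇒miss (absent B eB)))))
... | cut (suc zero) d present absent = Q-type
  (present (true ∷ []) refl) pair
  where
  pair : ∀ B → ∣ B ∣ ≡ 2 → g (false ∷ B) ≡ true
  pair B eB with g (false ∷ B) in gB
  ... | true = refl
  ... | false = contradiction few (≤⇒≯ (≤-trans (≤-reflexive (cong suc (sym et))) (≤-trans
    (sumAll-⊥+singles+large (λ P → miss (g (false ∷ P))) (false⇒miss g⊥)
      (λ D eD → false⇒miss (absent D eD)) B (≤-reflexive (sym eB)) (false⇒miss gB)) (m≤n+m _ _))))
... | cut (suc (suc z)) d present absent with d ≤? c
...   | yes d≤c = packed (true ∷ false ∷ ⊥) (cong suc (∣⊥∣≡0 (z + d)))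
  (subst (λ P → g (true ∷ false ∷ P) ≡ true) (⊥-++ z) (present (true ∷ false ∷ ⊥) (cong suc (∣⊥∣≡0 z))))
  (subst (TailPack g ⊤) (+-identityʳ _) (tailPack-⊤ (tailPack-singles {suc (suc z)} {j = 0} (⊤ {d}) present (λ _ → nil) (2 + c) ⊤
    (≤-trans (s≤s (s≤s c≤z)) (≤-reflexive (sym (∣⊤∣≡n (2 + z))))))))
  where
  c≤z : c ≤ z
  c≤z = +-cancelʳ-≤ c c z (≤-trans (≤-reflexive (trans (lem c) (sym (cong (pred ∘ pred) et)))) (+-monoʳ-≤ z d≤c))
    where
    lem : ∀ c → c + c ≡ 2 * c
    lem = solve-∀
...   | no d≰c with half-split z d c (cong (pred ∘ pred) et) (≰⇒> d≰c)
...     | e , 1≤e , refl , refl = classify-matching z e g 1≤e cl few g⊥ present absent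

-- Packing disjoint members

sep-trans : ∀ {n} {W B U A V : Subset n} → Sep W B U → Sep U A V → Sep W A V
sep-trans [] [] = []
sep-trans (skip s) (skip r) = skip (sep-trans s r)
sep-trans (left s) (skip r) = skip (sep-trans s r)
sep-trans (right s) (skip r) = skip (sep-trans s r)
sep-trans (right s) (left r) = left (sep-trans s r)
sep-trans (right s) (right r) = right (sep-trans s r)

sep-refine : ∀ {n} {Y B Y′ B₁ B₂ : Subset n} → Sep Y B Y′ → Sep B B₁ B₂ → ∃ λ Y₁ → Sep Y B₁ Y₁ × Sep Y₁ B₂ Y′
sep-refine [] [] = [] , [] , []
sep-refine (skip s) (skip r) = let Y₁ , s₁ , s₂ = sep-refine s r in false ∷ Y₁ , skip s₁ , skip s₂
sep-refine (left s) (skip r) = let Y₁ , s₁ , s₂ = sep-refine s r in false ∷ Y₁ , skip s₁ , skip s₂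
sep-refine (left s) (left r) = let Y₁ , s₁ , s₂ = sep-refine s r in false ∷ Y₁ , left s₁ , skip s₂
sep-refine (left s) (right r) = let Y₁ , s₁ , s₂ = sep-refine s r in true ∷ Y₁ , right s₁ , left s₂
sep-refine (right s) (skip r) = let Y₁ , s₁ , s₂ = sep-refine s r in true ∷ Y₁ , right s₁ , right s₂

sep-⊥ʳ : ∀ {n} (P : Subset n) → Sep P P ⊥
sep-⊥ʳ [] = []
sep-⊥ʳ (true ∷ P) = left (sep-⊥ʳ P)
sep-⊥ʳ (false ∷ P) = skip (sep-⊥ʳ P)

sep-complement : ∀ {n} (P : Subset n) → ∃ λ V → Sep ⊤ P V × ∣ P ∣ + ∣ V ∣ ≡ n
sep-complement [] = [] , [] , refl
sep-complement (true ∷ P) = let V , s , e = sep-complement P in false ∷ V , left s , cong suc e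
sep-complement (false ∷ P) = let V , s , e = sep-complement P in true ∷ V , right s , trans (+-suc ∣ P ∣ _) (cong suc e)

-- Members are kept nonempty because `HasDisjointMembers` also asks for distinct sets, and two
-- copies of the empty set are disjoint.
data Pack {n} (F : Family n) : Subset n → ℕ → Set where
  nil  : ∀ {U} → Pack F U 0
  cons : ∀ {U A V j} → Sep U A V → F A ≡ true → 1 ≤ ∣ A ∣ → Pack F V j → Pack F U (suc j)

pack-mono : ∀ {n} {F : Family n} {W B U j} → Sep W B U → Pack F U j → Pack F W j
pack-mono s nil = nil
pack-mono s (cons s′ FA ne p) = cons (sep-trans s s′) FA ne p

nonempty : ∀ {n} (A : Subset n) → 1 ≤ ∣ A ∣ → ∃ λ x → x ∈ A
nonempty (true ∷ A) h = zero , here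
nonempty (false ∷ A) h = let x , x∈A = nonempty A h in suc x , there x∈A

record Members {n} (F : Family n) (U : Subset n) (j : ℕ) : Set where
  field
    sets     : Fin j → Subset n
    member   : ∀ i → F (sets i) ≡ true
    inhabited : ∀ i → ∃ λ x → x ∈ sets i
    within   : ∀ i {x} → x ∈ sets i → x ∈ U
    disjoint : ∀ i k → i ≢ k → Disjoint (sets i) (sets k)
open Members

disjoint-sym : ∀ {n} {A B : Subset n} → Disjoint A B → Disjoint B A
disjoint-sym {A = A} {B} d (x , x∈) = let x∈B , x∈A = x∈p∩q⁻ B A x∈ in d (x , x∈p∩q⁺ (x∈A , x∈B))

disjoint⇒≢ : ∀ {n} {A B : Subset n} → Disjoint A B → (∃ λ x → x ∈ B) → A ≢ B
disjoint⇒≢ d (x , x∈B) refl = d (x , x∈p∩q⁺ (x∈B , x∈B))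

sep⇒disjoint : ∀ {n} {U A V B : Subset n} → Sep U A V → (∀ {x} → x ∈ B → x ∈ V) → Disjoint A B
sep⇒disjoint {A = A} {B = B} s B⊆V (x , x∈) = let x∈A , x∈B = x∈p∩q⁻ A B x∈ in sep-disjoint s x∈A (B⊆V x∈B)

pack⇒members : ∀ {n} {F : Family n} {U j} → Pack F U j → Members F U j
pack⇒members nil .sets ()
pack⇒members nil .member ()
pack⇒members nil .inhabited ()
pack⇒members nil .within ()
pack⇒members nil .disjoint ()
pack⇒members (cons {A = A} s FA ne p) .sets = A Fun.∷ sets (pack⇒members p)
pack⇒members (cons s FA ne p) .member zero = FA
pack⇒members (cons s FA ne p) .member (suc i) = member (pack⇒members p) i
pack⇒members (cons {A = A} s FA ne p) .inhabited zero = nonempty A ne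
pack⇒members (cons s FA ne p) .inhabited (suc i) = inhabited (pack⇒members p) i
pack⇒members (cons s FA ne p) .within zero = sep-∈ˡ s
pack⇒members (cons s FA ne p) .within (suc i) = sep-∈ʳ s ∘ within (pack⇒members p) i
pack⇒members (cons s FA ne p) .disjoint zero zero ne′ = contradiction refl ne′
pack⇒members (cons s FA ne p) .disjoint zero (suc k) _ = sep⇒disjoint s (within (pack⇒members p) k)
pack⇒members (cons s FA ne p) .disjoint (suc i) zero _ = disjoint-sym (sep⇒disjoint s (within (pack⇒members p) i))
pack⇒members (cons s FA ne p) .disjoint (suc i) (suc k) ne′ = disjoint (pack⇒members p) i k (ne′ ∘ cong suc)

pack⇒disjointMembers : ∀ {n} {F : Family n} {U j} → Pack F U j → HasDisjointMembers F j
pack⇒disjointMembers p = sets M , member M , λ i k ne →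
  disjoint M i k ne , disjoint⇒≢ (disjoint M i k ne) (inhabited M k)
  where M = pack⇒members p

-- P may be empty, all other members are not.
pack+P⇒disjointMembers : ∀ {n} {F : Family n} {P U V j} → F P ≡ true → Sep U P V → Pack F V j →
  HasDisjointMembers F (suc j)
pack+P⇒disjointMembers {F = F} {P} FP s p = P Fun.∷ sets M , mem , λ
  { zero zero ne → contradiction refl ne
  ; zero (suc k) _ → P∥ k , disjoint⇒≢ (P∥ k) (inhabited M k)
  ; (suc i) zero _ → disjoint-sym (P∥ i) , disjoint⇒≢ (P∥ i) (inhabited M i) ∘ sym
  ; (suc i) (suc k) ne → let d = disjoint M i k (ne ∘ cong suc) in d , disjoint⇒≢ d (inhabited M k) }
  where
  M = pack⇒members p
  P∥ : ∀ k → Disjoint P (sets M k)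
  P∥ k = sep⇒disjoint s (within M k)
  mem : ∀ i → F ((P Fun.∷ sets M) i) ≡ true
  mem zero = FP
  mem (suc i) = member M i

module Packing {f N t : ℕ} (m′ : ℕ) (1≤m′ : 1 ≤ m′) (F : Family (f + (N + t))) (cl : DomClosed F)
  (G : Subset N) (∣G∣ : ∣ G ∣ ≡ m′) where

  link : Subset t → Bool
  link S = F (⊥ {f} ++ (G ++ S))

  -- j disjoint nonempty members fit into Y, Z and any a elements of the front.
  record Packs (a : ℕ) (Y : Subset N) (Z : Subset t) (j : ℕ) : Set where
    field pack : ∀ (U : Subset f) → a ≤ ∣ U ∣ → Pack F (U ++ (Y ++ Z)) j
  open Packs public

  packs-≤ : ∀ {a b Y Z j} → a ≤ b → Packs a Y Z j → Packs b Y Z j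
  packs-≤ a≤b p .pack U h = pack p U (≤-trans a≤b h)

  packs-≡ : ∀ {a b Y Z j k} → a ≡ b → j ≡ k → Packs a Y Z j → Packs b Y Z k
  packs-≡ refl refl p = p

  packs-mono : ∀ {a Y B Y′ Z j} → Sep Y B Y′ → Packs a Y′ Z j → Packs a Y Z j
  packs-mono {Z = Z} s p .pack U h = pack-mono (sep-++ (sep-⊥ˡ U) (sep-++ s (sep-⊥ˡ Z))) (pack p U h)

  step : ∀ {a b Y B Y′ Z S Z′ j} → (∀ (A : Subset f) → ∣ A ∣ ≡ a → F (A ++ (B ++ S)) ≡ true) → 1 ≤ a + ∣ B ∣ →
    Sep Y B Y′ → Sep Z S Z′ → Packs b Y′ Z′ j → Packs (a + b) Y Z (suc j)
  step {a} {b} {B = B} {S = S} FA ne sY sZ p .pack U h with sep-choose a b U h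
  ... | A , U′ , sU , eA , h′ = cons (sep-++ sU (sep-++ sY sZ)) (FA A eA) ne′ (pack p U′ h′)
    where
    open ≤-Reasoning
    ne′ : 1 ≤ ∣ A ++ (B ++ S) ∣
    ne′ = begin
      1                          ≤⟨ ne ⟩
      a + ∣ B ∣                  ≡⟨ cong (_+ ∣ B ∣) (sym eA) ⟩
      ∣ A ∣ + ∣ B ∣              ≤⟨ +-monoʳ-≤ ∣ A ∣ (m≤m+n _ _) ⟩
      ∣ A ∣ + (∣ B ∣ + ∣ S ∣)    ≡⟨ cong (∣ A ∣ +_) (sym (∣++∣ B S)) ⟩
      ∣ A ∣ + ∣ B ++ S ∣         ≡⟨ sym (∣++∣ A (B ++ S)) ⟩
      ∣ A ++ (B ++ S) ∣          ∎

  -- All of `A` precedes `G` and is at least as large, so the surplus built up in the front covers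
  -- `G`; equality of the total sizes does the rest.
  front-dom : ∀ {S : Subset t} (A : Subset f) (B : Subset N) → m′ ≤ ∣ A ∣ →
    ∣ A ∣ + ∣ B ∣ ≡ ∣ S ∣ + m′ → Dom 0 0 (⊥ {f} ++ (G ++ S)) (A ++ (B ++ ⊥ {t}))
  front-dom {S} A B hA eq = dom-++ (dom-⊥ˡ 0 A) (dom-++ {k′ = ∣ S ∣}
    (dom-slack ∣ A ∣ ∣ S ∣ G B (≤-trans (≤-reflexive ∣G∣) hA) (trans eq (cong (∣ S ∣ +_) (sym ∣G∣))))
    (dom-slack ∣ S ∣ 0 S ⊥ ≤-refl (trans (cong (∣ S ∣ +_) (∣⊥∣≡0 t)) (+-identityʳ _))))

  front∪tail : ∀ {S} → link S ≡ true → ∀ (A : Subset f) → ∣ A ∣ ≡ m′ → F (A ++ (⊥ {N} ++ S)) ≡ true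
  front∪tail {S} gS A eA = cl (dom-++ (dom-⊥ˡ 0 A) (dom-++ {k′ = 0}
    (dom-slack ∣ A ∣ 0 G ⊥ (≤-reflexive (trans ∣G∣ (sym eA)))
      (trans (cong (∣ A ∣ +_) (∣⊥∣≡0 N)) (trans (+-identityʳ _) (trans eA (sym ∣G∣)))))
    (dom-refl S))) gS

  -- Two ways to form members without the tail: m front points, or m - 1 front points and one point
  -- of a missing block. A present tail singleton yields both by shifting its point forward; if the
  -- link contains ⊥, already m - 1 front points are a member.
  record Recycling : Set where
    field
      extra : ∀ {a Y Z j} → Packs a Y Z j → Packs (suc m′ + a) Y Z (suc j)
      reuse : ∀ {a Y B Y′ Z j} → Sep Y B Y′ → ∣ B ∣ ≡ 1 → Packs a Y′ Z j → Packs (m′ + a) Y Z (suc j)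
  open Recycling

  recycling-singleton : ∀ S → ∣ S ∣ ≡ 1 → link S ≡ true → Recycling
  recycling-singleton S eS gS .extra {a} {Y} {Z} = step {B = ⊥ {N}} {S = ⊥ {t}}
    (λ A eA → cl (front-dom {S} A ⊥ (≤-trans (n≤1+n m′) (≤-reflexive (sym eA)))
      (trans (cong₂ _+_ eA (∣⊥∣≡0 N)) (trans (+-identityʳ _) (cong (_+ m′) (sym eS))))) gS)
    (s≤s z≤n) (sep-⊥ˡ Y) (sep-⊥ˡ Z)
  recycling-singleton S eS gS .reuse {a} {Y} {B} {Y′} {Z} s eB = step {B = B} {S = ⊥ {t}}
    (λ A eA → cl (front-dom {S} A B (≤-reflexive (sym eA))
      (trans (cong₂ _+_ eA eB) (trans (+-comm m′ 1) (cong (_+ m′) (sym eS))))) gS)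
    (≤-trans 1≤m′ (m≤m+n m′ _)) s (sep-⊥ˡ Z)

  step-tail : ∀ {a Y Z S Z′ j} → link S ≡ true → Sep Z S Z′ → Packs a Y Z′ j → Packs (m′ + a) Y Z (suc j)
  step-tail {Y = Y} gS s = step {B = ⊥} (front∪tail gS) (≤-trans 1≤m′ (m≤m+n m′ _)) (sep-⊥ˡ Y) s

  recycling-⊥ : link ⊥ ≡ true → Recycling
  recycling-⊥ g⊥ .extra {a} {Y} {Z} p = packs-≤ (n≤1+n _) (step-tail g⊥ (sep-⊥ˡ Z) p)
  recycling-⊥ g⊥ .reuse {Y = Y} {Z = Z} s eB p =
    step-tail g⊥ (sep-⊥ˡ Z) (packs-mono s p)

  base : ∀ Y Z → Packs 0 Y Z 0
  base Y Z .pack U h = nil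

  tailPacks : ∀ {k a Y Z j} → TailPack link Z k → (∀ Z → Packs a Y Z j) → Packs (k * m′ + a) Y Z (k + j)
  tailPacks nil p = p _
  tailPacks {suc k} {a} (cons s gS T) p =
    packs-≡ (sym (+-assoc m′ (k * m′) a)) refl (step-tail gS s (tailPacks T p))

  module _ (rec : Recycling) where

    extras : ∀ k {a Y Z j} → Packs a Y Z j → Packs (k * suc m′ + a) Y Z (k + j)
    extras zero p = p
    extras (suc k) {a} p = packs-≡ (sym (+-assoc (suc m′) (k * suc m′) a)) refl (extra rec (extras k p))

    reuse-all : ∀ b {a Y B Y′ Z j} → Sep Y B Y′ → b ≤ ∣ B ∣ → Packs a Y′ Z j → Packs (b * m′ + a) Y Z (b + j)
    reuse-all zero s h p = packs-mono s p
    reuse-all (suc b) {a} {B = B} s h p with sep-choose 1 b B h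
    ... | B₁ , B₂ , sB , e₁ , h₂ with sep-refine s sB
    ...   | Y₁ , s₁ , s₂ = packs-≡ (sym (+-assoc m′ (b * m′) a)) refl (reuse rec s₁ e₁ (reuse-all b s₂ h₂ p))

    -- A missing block is traded for m members, one through each of its points, at a cost of m(m -
    -- 1) front points. An unspent unit of `r` buys m - 1 members of m front points at the same
    -- cost. Hence the number of members and the front points used do not depend on how many blocks
    -- are missing.
    partitionPacks : ∀ {r Y p a Z j} → Partition (λ A → F (⊥ {f} ++ (A ++ ⊥))) (suc m′) r Y p →
      (∀ Y → Packs a Y Z j) → Packs (r * (suc m′ * m′) + a) Y Z (p + r * m′ + j)
    partitionPacks {r} {a = a} nil q = packs-≡ (lem r m′ a) refl (extras (r * m′) (q _))
      where
      lem : ∀ r m a → r * m * suc m + a ≡ r * (suc m * m) + a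
      lem = solve-∀
    partitionPacks (good {A = A} s eA FA P) q = step {a = 0} {B = A} {S = ⊥}
      (λ A₀ e₀ → subst (λ A₀ → F (A₀ ++ (A ++ ⊥)) ≡ true) (sym (∣p∣≡0⇒p≡⊥ A₀ e₀)) FA)
      (≤-trans (s≤s z≤n) (≤-reflexive (sym eA))) s (sep-⊥ˡ _) (partitionPacks P q)
    partitionPacks {suc r} {p = suc p} {a} {j = j} (bad s eA P) q = packs-≡ (lem₁ r m′ a) (lem₂ p r m′ j)
      (reuse-all (suc m′) s (≤-reflexive (sym eA)) (partitionPacks P q))
      where
      lem₁ : ∀ r m a → suc m * m + (r * (suc m * m) + a) ≡ suc r * (suc m * m) + a
      lem₁ = solve-∀
      lem₂ : ∀ p r m j → suc m + (p + r * m + j) ≡ suc p + suc r * m + j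
      lem₂ = solve-∀

-- Here `m` stands for m - 1, and `u`, `v` are the numbers of head and tail points of a member
-- outside Q. Of c further members, `e` lie in the front, each costing one front point more than a
-- tail pair would, and `w` use tail pairs. Taking `e` as large as the slack m - u allows, the
-- defining inequality of "outside Q" leaves enough tail for the pairs.
allot : ∀ u v m c → v + u + u ≤ 1 + 2 * m → v ≤ 1 + 2 * c →
  ∃ λ e → ∃ λ w → e + w ≡ c × u + e ≤ m × w * 2 + v ≤ 1 + 2 * c
allot u v m c h hv with u ≤? m
... | no ¬p = contradiction h (<⇒≱ (≤-trans (≤-trans (≤-reflexive (lem m)) (+-mono-≤ (≰⇒> ¬p) (≰⇒> ¬p)))
    (≤-trans (m≤n+m (u + u) v) (≤-reflexive (sym (+-assoc v u u))))))
  where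
  lem : ∀ m → suc (1 + 2 * m) ≡ suc m + suc m
  lem = solve-∀
... | yes u≤m with m≤n⇒∃[o]m+o≡n u≤m
...   | r , refl with c ≤? r
...     | yes c≤r = c , 0 , +-identityʳ c , +-monoʳ-≤ u c≤r , hv
...     | no c≰r with m≤n⇒∃[o]m+o≡n (<⇒≤ (≰⇒> c≰r))
...       | w , refl = r , w , refl , ≤-refl , +-cancelʳ-≤ (u + u) _ _
  (≤-trans (≤-reflexive (lem₁ w v u)) (≤-trans (+-monoʳ-≤ (w * 2) h) (≤-reflexive (lem₂ w u r))))
  where
  lem₁ : ∀ w v u → w * 2 + v + (u + u) ≡ w * 2 + (v + u + u)
  lem₁ = solve-∀
  lem₂ : ∀ w u r → w * 2 + (1 + 2 * (u + r)) ≡ 1 + 2 * (r + w) + (u + u)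
  lem₂ = solve-∀

-- The first `d` tail points are treated as part of the head: one for Q, two for W. All head points
-- move to the start of the front, which frees the middle and these `d` points for other members.
shift-to-front : ∀ {f N d t} {F : Family (f + (N + (d + t)))} → DomClosed F → ∀ P → F P ≡ true →
  ∣p∩[ f + (N + d) ]∣ P ≤ f →
  ∃ λ (T : Subset t) → ∣ P ∣ ≡ ∣p∩[ f + (N + d) ]∣ P + ∣ T ∣ ×
    F (initial f (∣p∩[ f + (N + d) ]∣ P) ++ (⊥ {N} ++ (⊥ {d} ++ T))) ≡ true
shift-to-front {f} {N} {d} {t} {F} cl P FP u≤f with splitAt f P
... | A , P′ , refl with splitAt N P′
...   | B , P″ , refl with splitAt d P″
...     | D , T , refl = T , size , cl (dom-++ {k′ = ∣ B ∣ + ∣ D ∣}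
  (dom-initial 0 _ u A u≤f (trans u≡ (+-comm ∣ A ∣ _)))
  (dom-++ {k′ = ∣ D ∣} (dom-slack _ ∣ D ∣ B ⊥ (m≤m+n _ _)
    (trans (cong (∣ B ∣ + ∣ D ∣ +_) (∣⊥∣≡0 N)) (trans (+-identityʳ _) (+-comm ∣ B ∣ _))))
    (dom-++ {k′ = 0} (dom-slack _ 0 D ⊥ ≤-refl (trans (cong (∣ D ∣ +_) (∣⊥∣≡0 d)) (+-identityʳ _))) (dom-refl T)))) FP
  where
  u = ∣p∩[ f + (N + d) ]∣ (A ++ (B ++ (D ++ T)))
  u≡ : u ≡ ∣ A ∣ + (∣ B ∣ + ∣ D ∣)
  u≡ = trans (∣p∩[]∣-++ (N + d) A _) (cong (∣ A ∣ +_) (trans (∣p∩[]∣-++ d B _) (cong (∣ B ∣ +_)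
    (trans (cong (λ k → ∣p∩[ k ]∣ (D ++ T)) (sym (+-identityʳ d))) (trans (∣p∩[]∣-++ 0 D T) (+-identityʳ _))))))
  size : ∣ A ++ (B ++ (D ++ T)) ∣ ≡ u + ∣ T ∣
  size = begin
    ∣ A ++ (B ++ (D ++ T)) ∣              ≡⟨ ∣++∣ A _ ⟩
    ∣ A ∣ + ∣ B ++ (D ++ T) ∣             ≡⟨ cong (∣ A ∣ +_) (trans (∣++∣ B _) (cong (∣ B ∣ +_) (∣++∣ D T))) ⟩
    ∣ A ∣ + (∣ B ∣ + (∣ D ∣ + ∣ T ∣))     ≡⟨ lem (∣ A ∣) (∣ B ∣) (∣ D ∣) (∣ T ∣) ⟩
    ∣ A ∣ + (∣ B ∣ + ∣ D ∣) + ∣ T ∣       ≡⟨ cong (_+ ∣ T ∣) (sym u≡) ⟩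
    u + ∣ T ∣                             ∎
    where
    open ≡-Reasoning
    lem : ∀ a b c d → a + (b + (c + d)) ≡ a + (b + c) + d
    lem = solve-∀

module Construction {f N m′ c p : ℕ} (1≤m′ : 1 ≤ m′) (1≤c : 1 ≤ c)
  (f≡ : f ≡ (2 + 2 * c) * (suc m′ * m′) + (2 + c) * m′)
  (F : Family (f + (N + (2 + 2 * c)))) (cl : DomClosed F)
  (G : Subset N) (∣G∣ : ∣ G ∣ ≡ m′)
  (P : Partition (λ A → F (⊥ {f} ++ (A ++ ⊥ {2 + 2 * c}))) (suc m′) (2 + 2 * c) ⊤ p)
  (few : sumAll (2 + 2 * c) (λ S → miss (F (⊥ {f} ++ (G ++ S)))) < 3 + 2 * c) where

  open Packing {f} {N} {2 + 2 * c} m′ 1≤m′ F cl G ∣G∣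

  -- This is s: one member per block, m - 1 more for each unit of the allowance for missing blocks,
  -- and 2 + c from the tail.
  target : ℕ
  target = p + (2 + 2 * c) * m′ + (2 + c)

  link-closed : DomClosed link
  link-closed d = cl (dom-++ (dom-refl (⊥ {f})) (dom-++ (dom-refl G) d))

  m′≤f : m′ ≤ f
  m′≤f = ≤-trans (≤-trans (m≤m+n m′ ((1 + c) * m′)) (m≤n+m _ ((2 + 2 * c) * (suc m′ * m′)))) (≤-reflexive (sym f≡))

  without-head : Recycling → TailPack link ⊤ (2 + c) → HasDisjointMembers F target
  without-head rec T = pack⇒disjointMembers (pack full ⊤ (≤-reflexive (sym (trans (∣⊤∣≡n f) f≡))))
    where
    full : Packs ((2 + 2 * c) * (suc m′ * m′) + (2 + c) * m′) ⊤ ⊤ target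
    full = packs-≡ (cong ((2 + 2 * c) * (suc m′ * m′) +_) (+-identityʳ _))
      (cong (p + (2 + 2 * c) * m′ +_) (+-identityʳ (2 + c)))
      (partitionPacks rec P (λ Y → tailPacks T (base Y)))

  -- The shifted member takes the place of one of the last 2 + c. The other 1 + c are `k` tail sets
  -- and `e` sets inside the front, and `fits` says that together with the head they stay within the
  -- reserve of (2 + c)(m - 1) front points.
  with-head : ∀ {A Z} k e u → Recycling → u ≤ f → F (initial f u ++ (⊥ {N} ++ A)) ≡ true → Sep ⊤ A Z → TailPack link Z k →
    k + e ≡ 1 + c → k * m′ + e * suc m′ + u ≤ (2 + c) * m′ → HasDisjointMembers F target
  with-head {A} {Z} k e u rec u≤f FA s T eq fits = subst (HasDisjointMembers F) count
    (pack+P⇒disjointMembers FA (sep-++ (sep-initial f u) (sep-++ (sep-⊥ˡ ⊤) s)) (pack rest (final f u) room))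
    where
    rest : Packs ((2 + 2 * c) * (suc m′ * m′) + (k * m′ + (e * suc m′ + 0))) ⊤ Z (p + (2 + 2 * c) * m′ + (k + (e + 0)))
    rest = partitionPacks rec P (λ Y → tailPacks T (λ Z → extras rec e (base Y Z)))
    count : suc (p + (2 + 2 * c) * m′ + (k + (e + 0))) ≡ target
    count = trans (sym (+-suc (p + (2 + 2 * c) * m′) _))
      (cong (λ x → p + (2 + 2 * c) * m′ + suc x) (trans (cong (k +_) (+-identityʳ e)) eq))
    room : (2 + 2 * c) * (suc m′ * m′) + (k * m′ + (e * suc m′ + 0)) ≤ ∣ final f u ∣
    room = +-cancelʳ-≤ u _ _ (begin
      X + (k * m′ + (e * suc m′ + 0)) + u      ≡⟨ lem X (k * m′) (e * suc m′) u ⟩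
      X + (k * m′ + e * suc m′ + u)            ≤⟨ +-monoʳ-≤ X fits ⟩
      X + (2 + c) * m′                         ≡⟨ sym f≡ ⟩
      f                                        ≡⟨ sym (∣final∣ f u u≤f) ⟩
      ∣ final f u ∣ + u                        ∎)
      where
      open ≤-Reasoning
      X = (2 + 2 * c) * (suc m′ * m′)
      lem : ∀ x a b u → x + (a + (b + 0)) + u ≡ x + (a + b + u)
      lem = solve-∀

  -- As the total is ms + c with 2c + 2 points in the tail, `f + (N + 1)` is ms - c - 1, the cut in
  -- the definition of Q. For c = 1, `f + (N + 2)` is ms - 1, the cut for W.
  OutsideQ OutsideW : Set
  OutsideQ = ∃ λ A → F A ≡ true × ∣ A ∣ + ∣p∩[ f + (N + 1) ]∣ A < 2 * suc m′
  OutsideW = ∃ λ A → F A ≡ true × ∣p∩[ f + (N + 2) ]∣ A < suc m′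

  construct-Q : link (true ∷ ⊥) ≡ true → (∀ B → ∣ B ∣ ≡ 2 → link (false ∷ B) ≡ true) → OutsideQ →
    HasDisjointMembers F target
  construct-Q g₀ pairs (A , FA , small) =
    let T , size , FT = shift-to-front {f} {N} {1} cl A FA u≤f
        V , s , ∣T∣+∣V∣ = sep-complement T
        e , w , e+w≡c , u+e≤m′ , fits = allot u (∣ T ∣) m′ c
          (≤-trans (≤-reflexive (cong (_+ u) (trans (+-comm ∣ T ∣ u) (sym size)))) small′)
          (≤-trans (m≤m+n _ _) (≤-reflexive (trans ∣T∣+∣V∣ (lem₀ c))))
    in with-head (suc w) e u (recycling-singleton (true ∷ ⊥) (cong suc (∣⊥∣≡0 (1 + 2 * c))) g₀) u≤f FT (right s)
      (cons (left (sep-⊥ˡ V)) g₀ (tailPack-pairs pairs w false V (+-cancelʳ-≤ (∣ T ∣) _ _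
        (≤-trans fits (≤-reflexive (trans (sym (lem₀ c)) (trans (sym ∣T∣+∣V∣) (+-comm ∣ T ∣ ∣ V ∣))))))))
      (cong suc (trans (+-comm w e) e+w≡c))
      (≤-trans (≤-reflexive (lem₁ m′ w e u)) (≤-trans (+-monoʳ-≤ (m′ + (e + w) * m′) u+e≤m′)
        (≤-reflexive (trans (cong (λ x → m′ + x * m′ + m′) e+w≡c) (lem₂ m′ c)))))
    where
    open ≤-Reasoning
    u = ∣p∩[ f + (N + 1) ]∣ A
    lem₀ : ∀ c → suc (c + (c + 0)) ≡ 1 + 2 * c
    lem₀ = solve-∀
    lem₁ : ∀ m w e u → suc w * m + e * suc m + u ≡ m + (e + w) * m + (u + e)
    lem₁ = solve-∀
    lem₂ : ∀ m c → m + c * m + m ≡ (2 + c) * m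
    lem₂ = solve-∀
    small′ : ∣ A ∣ + u ≤ 1 + 2 * m′
    small′ = ≤-trans (≤-pred small) (≤-reflexive (lem m′))
      where
      lem : ∀ m → m + suc (m + 0) ≡ 1 + 2 * m
      lem = solve-∀
    u≤f : u ≤ f
    u≤f = begin
      u                ≤⟨ m≤n+m u ∣ A ∣ ⟩
      ∣ A ∣ + u        ≤⟨ small′ ⟩
      1 + 2 * m′       ≤⟨ +-monoˡ-≤ (2 * m′) 1≤m′ ⟩
      3 * m′           ≤⟨ *-monoˡ-≤ m′ (s≤s (s≤s 1≤c)) ⟩
      (2 + c) * m′     ≤⟨ m≤n+m _ ((2 + 2 * c) * (suc m′ * m′)) ⟩
      _                ≡⟨ sym f≡ ⟩
      f                ∎

  construct-W : c ≡ 1 → link (true ∷ false ∷ ⊥) ≡ true → TailPack link (true ∷ true ∷ ⊥) 2 → OutsideW →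
    HasDisjointMembers F target
  construct-W refl g₀ T (A , FA , s≤s small) =
    let A′ , size , FA′ = shift-to-front {f} {N} {2} cl A FA (≤-trans small m′≤f)
    in with-head 2 0 _ (recycling-singleton (true ∷ ⊥) (cong suc (∣⊥∣≡0 3)) g₀) (≤-trans small m′≤f) FA′
      (right (right (sep-⊤ (sep-⊥ʳ A′)))) T refl (≤-trans (+-monoʳ-≤ _ small) (≤-reflexive (lem m′)))
    where
    lem : ∀ m → 2 * m + 0 * suc m + m ≡ 3 * m
    lem = solve-∀

  construct : OutsideQ → (c ≡ 1 → OutsideW) → HasDisjointMembers F target
  construct ∉Q ∉W with classify c link refl 1≤c link-closed few
  ... | empty g⊥ = without-head (recycling-⊥ g⊥) (copies (2 + c))
    where
    copies : ∀ k → TailPack link ⊤ k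
    copies zero = nil
    copies (suc k) = cons (sep-⊥ˡ ⊤) g⊥ (copies k)
  ... | packed S eS gS T = without-head (recycling-singleton S eS gS) T
  ... | Q-type g₀ pairs = construct-Q g₀ pairs ∉Q
  ... | W-type c≡1 g₀ T = construct-W c≡1 g₀ T (∉W c≡1)

-- The bound

-- Room for (m−1)-sets to be joined with 2+c disjoint tail sets and with each of the m elements
-- of up to 2+2c missing m-sets.
front : ℕ → ℕ → ℕ
front m′ c = (2 + 2 * c) * (suc m′ * m′) + (2 + c) * m′

OutsideQ : ∀ {n} → Family n → (m k : ℕ) → Set
OutsideQ F m k = ∃ λ A → F A ≡ true × ∣ A ∣ + ∣p∩[ k ]∣ A < 2 * m

OutsideW : ∀ {n} → Family n → (m k : ℕ) → Set
OutsideW F m k = ∃ λ A → F A ≡ true × ∣p∩[ k ]∣ A < m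

sumAll-middle≤ : ∀ f N t (F : Family (f + (N + t))) →
  sumAll N (λ A → sumAll t (λ S → miss (F (⊥ {f} ++ (A ++ S))))) ≤ complementSize F
sumAll-middle≤ f N t F = begin
  sumAll N (λ A → sumAll t (λ S → miss (F (⊥ {f} ++ (A ++ S)))))        ≡⟨ sym (sumAll-++ N _) ⟩
  sumAll (N + t) (λ B → miss (F (⊥ {f} ++ B)))
    ≤⟨ term≤sumAll f (λ U → sumAll (N + t) (λ B → miss (F (U ++ B)))) ⊥ ⟩
  sumAll f (λ U → sumAll (N + t) (λ B → miss (F (U ++ B))))             ≡⟨ sym (sumAll-++ f _) ⟩
  sumAll (f + (N + t)) (miss ∘ F)                                       ≡⟨ sym (complementSize≡ F) ⟩
  complementSize F                                                      ∎
  where open ≤-Reasoning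

-- The bound in terms of the middle alone has no error term; one arises only when the binomial
-- coefficient is compared with that of n.
complement-bound : ∀ m′ c p {n} (F : Family n) → 1 ≤ m′ → 1 ≤ c →
  n ≡ front m′ c + (suc p * suc m′ + (2 + 2 * c)) →
  DomClosed F → νLess F (suc p + (2 + 2 * c) * m′ + (2 + c)) →
  OutsideQ F (suc m′) (front m′ c + (suc p * suc m′ + 1)) →
  (c ≡ 1 → OutsideW F (suc m′) (front m′ c + (suc p * suc m′ + 2))) →
  (3 + 2 * c) * ((suc p * suc m′ ∸ 1) C m′) ≤ complementSize F
complement-bound m′ c p F 1≤m′ 1≤c refl cl ν ∉Q ∉W = ≮⇒≥ λ lt →
  let G , _ , (_ , ∣G∣ , _) , few = Σ⊆-search ⊤ m′ (tail< lt)
  in ν (Construction.construct {f} {N} 1≤m′ 1≤c refl F cl G ∣G∣ (blocks-of lt) few ∉Q ∉W)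
  where
  open ≤-Reasoning
  f = front m′ c
  N = suc p * suc m′
  t = 2 + 2 * c
  W = (N ∸ 1) C m′
  tails : Subset N → ℕ
  tails G = sumAll t (λ S → miss (F (⊥ {f} ++ (G ++ S))))
  mid : Family N
  mid A = F (⊥ {f} ++ (A ++ ⊥ {t}))
  tail< : complementSize F < (3 + 2 * c) * W →
    Σ⊆ ⊤ m′ (λ G _ → tails G) < Σ⊆ (⊤ {N}) m′ (λ _ _ → 3 + 2 * c)
  tail< lt = begin-strict
    Σ⊆ ⊤ m′ (λ G _ → tails G)             ≤⟨ Σ⊆≤sumAll ⊤ m′ tails ⟩
    sumAll N tails                        ≤⟨ sumAll-middle≤ f N t F ⟩
    complementSize F                      <⟨ lt ⟩
    (3 + 2 * c) * W                       ≡⟨ *-comm (3 + 2 * c) W ⟩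
    -- Averaging over `G` alone would tolerate the larger `N C m′`; the value `W` is dictated by the
    -- partition into blocks.
    W * (3 + 2 * c)                       ≤⟨ *-monoˡ-≤ (3 + 2 * c) (C-monoˡ (N ∸ 1) m′) ⟩
    (N C m′) * (3 + 2 * c)                ≡⟨ cong (λ x → (x C m′) * (3 + 2 * c)) (sym (∣⊤∣≡n N)) ⟩
    (∣ ⊤ {N} ∣ C m′) * (3 + 2 * c)        ≡⟨ sym (Σ⊆-const (⊤ {N}) m′ (3 + 2 * c)) ⟩
    Σ⊆ (⊤ {N}) m′ (λ _ _ → 3 + 2 * c)     ∎
  blocks-of : complementSize F < (3 + 2 * c) * W → Partition mid (suc m′) (2 + 2 * c) ⊤ (suc p)
  blocks-of lt = partition′ mid m′ p (2 + 2 * c) ⊤ (∣⊤∣≡n N) (begin-strict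
    missing mid (suc m′) ⊤                ≤⟨ Σ⊆≤sumAll ⊤ (suc m′) (miss ∘ mid) ⟩
    sumAll N (miss ∘ mid)                 ≤⟨ sumAll-mono N (λ A → term≤sumAll t (λ S → miss (F (⊥ {f} ++ (A ++ S)))) ⊥) ⟩
    sumAll N tails                        ≤⟨ sumAll-middle≤ f N t F ⟩
    complementSize F                      <⟨ lt ⟩
    (3 + 2 * c) * W                       ∎)

outsideQ : ∀ m s c k {n} (F : Family n) → m * s ≡ k + 1 + c → NotSubfamily F (InQ m s c) → OutsideQ F m k
outsideQ m s c k F eq (A , FA , A∉Q) = A , FA , subst (λ x → ∣ A ∣ + x < 2 * m)
  (trans (cong (λ x → countUpTo x A) k≡) (countUpTo≡ k A)) (≰⇒> A∉Q)
  where
  k≡ : m * s ∸ c ∸ 1 ≡ k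
  k≡ = trans (cong (λ x → x ∸ c ∸ 1) eq) (trans (cong (_∸ 1) (m+n∸n≡m (k + 1) c)) (m+n∸n≡m k 1))

outsideW : ∀ m s k {n} (F : Family n) → m * s ≡ k + 1 → NotSubfamily F (InW m s) → OutsideW F m k
outsideW m s k F eq (A , FA , A∉W) = A , FA , subst (_< m)
  (trans (cong (λ x → countUpTo x A) k≡) (countUpTo≡ k A)) (≰⇒> A∉W)
  where
  k≡ : m * s ∸ 1 ≡ k
  k≡ = trans (cong (_∸ 1) eq) (m+n∸n≡m k 1)

^-distribʳ-* : ∀ j a b → (a * b) ^ j ≡ a ^ j * b ^ j
^-distribʳ-* zero a b = refl
^-distribʳ-* (suc j) a b = trans (cong (a * b *_) (^-distribʳ-* j a b)) (lem a b (a ^ j) (b ^ j))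
  where
  lem : ∀ a b x y → a * b * (x * y) ≡ a * x * (b * y)
  lem = solve-∀

-- Passing from pm - 1 to n takes `d` Pascal steps, each adding at most n^(m-2), and n ≤ (m + c)s.
binomial-bound : ∀ j c p s n d → n ≡ d + (suc p * suc (suc j) ∸ 1) → n ≡ suc (suc j) * s + c → 1 ≤ s →
  n C suc j ≤ ((suc p * suc (suc j) ∸ 1) C suc j) + d * (suc (suc j) + c) ^ j * s ^ j
binomial-bound j c p s n d refl eq 1≤s = begin
  (d + b) C suc j                              ≤⟨ [a+d]C≤ b d j ⟩
  b C suc j + d * (d + b) ^ j                  ≤⟨ +-monoʳ-≤ (b C suc j) (*-monoʳ-≤ d (^-monoˡ-≤ j n≤)) ⟩
  b C suc j + d * ((m + c) * s) ^ j            ≡⟨ cong (λ x → b C suc j + d * x) (^-distribʳ-* j (m + c) s) ⟩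
  b C suc j + d * ((m + c) ^ j * s ^ j)        ≡⟨ cong (b C suc j +_) (sym (*-assoc d _ _)) ⟩
  b C suc j + d * (m + c) ^ j * s ^ j          ∎
  where
  open ≤-Reasoning
  m = suc (suc j)
  b = suc p * m ∸ 1
  instance _ = >-nonZero 1≤s
  n≤ : d + b ≤ (m + c) * s
  n≤ = begin
    d + b              ≡⟨ eq ⟩
    m * s + c          ≤⟨ +-monoʳ-≤ (m * s) (m≤m*n c s) ⟩
    m * s + c * s      ≡⟨ sym (*-distribʳ-+ s m c) ⟩
    (m + c) * s        ∎

theorem4 : (m c : ℕ) → 2 ≤ m → 1 ≤ c →
    ∃ λ (K : ℕ) → ∃ λ (s₀ : ℕ) → 1 ≤ K × 1 ≤ s₀ ×
    ((s : ℕ) → s₀ ≤ s → (F : Family (m * s + c)) → Shifted F → νLess F s →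
    ((2 ≤ c × NotSubfamily F (InQ m s c))
    ⊎ (c ≡ 1 × NotSubfamily F (InQ m s c) × NotSubfamily F (InW m s))) →
    (2 * c + 3) * ((m * s + c) C (m ∸ 1)) ≤ complementSize F + K * s ^ (m ∸ 2))
theorem4 (suc (suc j)) c (s≤s (s≤s z≤n)) 1≤c =
  -- The `suc` only makes the constant visibly positive.
  suc ((3 + 2 * c) * (d * (m + c) ^ j)) , s₀ , s≤s z≤n , s≤s z≤n , λ s s₀≤s F sh ν outside →
    main s (proj₁ (m≤n⇒∃[o]m+o≡n s₀≤s)) (proj₂ (m≤n⇒∃[o]m+o≡n s₀≤s)) F (shifted⇒domClosed sh) ν outside
  where
  m = suc (suc j)
  -- The points outside the middle, namely the front and 2 + 2c tail points, plus one for the -1 in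
  -- C(pm - 1, m - 1).
  d = 3 + 2 * c + front (suc j) c
  -- The members beyond one per block, plus one, so that `s = s₀ + p` gives a middle of `suc p`
  -- blocks.
  s₀ = suc ((2 + 2 * c) * suc j + (2 + c))
  main : ∀ s p → s₀ + p ≡ s → (F : Family (m * s + c)) → DomClosed F → νLess F s →
    ((2 ≤ c × NotSubfamily F (InQ m s c)) ⊎ (c ≡ 1 × NotSubfamily F (InQ m s c) × NotSubfamily F (InW m s))) →
    (2 * c + 3) * ((m * s + c) C suc j) ≤ complementSize F + suc ((3 + 2 * c) * (d * (m + c) ^ j)) * s ^ j
  main s p refl F cl ν outside = begin
    (2 * c + 3) * ((m * s + c) C suc j)        ≡⟨ cong (_* ((m * s + c) C suc j)) (+-comm (2 * c) 3) ⟩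
    (3 + 2 * c) * ((m * s + c) C suc j)
      ≤⟨ *-monoʳ-≤ (3 + 2 * c) (binomial-bound j c p s (m * s + c) d (size′ j c p) refl (s≤s z≤n)) ⟩
    (3 + 2 * c) * (b + d * (m + c) ^ j * s ^ j)          ≡⟨ lem (3 + 2 * c) b (d * (m + c) ^ j) (s ^ j) ⟩
    (3 + 2 * c) * b + (3 + 2 * c) * (d * (m + c) ^ j) * s ^ j
      ≤⟨ +-mono-≤ (complement-bound (suc j) c p F (s≤s z≤n) 1≤c (size j c p) cl
             (subst (νLess F) (count j c p) ν) (∉Q outside) (∉W outside))
           (*-monoˡ-≤ (s ^ j) (n≤1+n ((3 + 2 * c) * (d * (m + c) ^ j)))) ⟩
    complementSize F + suc ((3 + 2 * c) * (d * (m + c) ^ j)) * s ^ j   ∎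
    where
    open ≤-Reasoning
    b = (suc p * m ∸ 1) C suc j
    lem : ∀ a b x y → a * (b + x * y) ≡ a * b + a * x * y
    lem = solve-∀
    count : ∀ j c p → suc ((2 + 2 * c) * suc j + (2 + c)) + p ≡ suc p + (2 + 2 * c) * suc j + (2 + c)
    count = solve-∀
    head-size : ∀ j c p → suc (suc j) * (suc ((2 + 2 * c) * suc j + (2 + c)) + p) ≡
      ((2 + 2 * c) * (suc (suc j) * suc j) + (2 + c) * suc j) + (suc p * suc (suc j) + 1) + 1 + c
    head-size = solve-∀
    size : ∀ j c p → suc (suc j) * (suc ((2 + 2 * c) * suc j + (2 + c)) + p) + c ≡
      ((2 + 2 * c) * (suc (suc j) * suc j) + (2 + c) * suc j) + (suc p * suc (suc j) + (2 + 2 * c))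
    size = solve-∀
    size′ : ∀ j c p → suc (suc j) * (suc ((2 + 2 * c) * suc j + (2 + c)) + p) + c ≡
      3 + 2 * c + ((2 + 2 * c) * (suc (suc j) * suc j) + (2 + c) * suc j) + (suc j + p * suc (suc j))
    size′ = solve-∀
    ∉Q : _ → OutsideQ F m (front (suc j) c + (suc p * m + 1))
    ∉Q (inj₁ (_ , F⊈Q)) = outsideQ m s c (front (suc j) c + (suc p * m + 1)) F (head-size j c p) F⊈Q
    ∉Q (inj₂ (_ , F⊈Q , _)) = outsideQ m s c (front (suc j) c + (suc p * m + 1)) F (head-size j c p) F⊈Q
    ∉W : _ → c ≡ 1 → OutsideW F m (front (suc j) c + (suc p * m + 2))
    ∉W (inj₁ (s≤s () , _)) refl
    ∉W (inj₂ (_ , _ , F⊈W)) refl = outsideW m s (front (suc j) 1 + (suc p * m + 2)) F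
      (trans (head-size j 1 p) (lem′ (front (suc j) 1) (suc p * m))) F⊈W
      where
      lem′ : ∀ f n → f + (n + 1) + 1 + 1 ≡ f + (n + 2) + 1
      lem′ = solve-∀
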